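{- Let $u,v,w,n$ be non-negative integers. Let $A(u,v,w,n)$ denote the number of partitions of $n$ into distinct parts, each congruent to $4$, $6$ or $9$ modulo $10$, with exactly $u$ parts congruent to $4$, $v$ parts congruent to $6$ and $w$ parts congruent to $9$ modulo $10$. Let $B(u,v,w,n)$ denote the number of partitions $\lambda_1+\cdots+\lambda_s$ of $n$ (parts in decreasing order) such that: (1) no part is equal to $2,3,5,8$ or congruent to $1,7,11,12,17 \bmod 20$; (2) $u$ equals the number of parts congruent to $0,3,4 \bmod 10$ plus twice the number of parts congruent to $18\bmod 20$; (3) $v$ equals the number of parts congruent to $0,5,6\bmod 10$ plus twice the number of parts congruent to $2\bmod 20$; (4) $w$ equals the number of parts congruent to $3,5,9\bmod 10$ plus twice the number of parts congruent to $8\bmod 20$; (5) any two consecutive parts differ by at least $9$, and whenever $9\le\lambda_i-\lambda_{i+1}\le 20$, the residue of $\lambda_i$ modulo $20$ belongs to the set given by the following list according to the value of $\lambda_i-\lambda_{i+1}$: - difference $9$: $\{4,19\}$; - difference $10$: $\emptyset$ (so this difference does not occur); - difference $11$: $\{4,6,10,15\}$; - difference $12$: $\{6,15,16\}$; - difference $13$: $\{3,6,9,16,19\}$; - difference $14$: $\{4,9,10,13,19\}$; - difference $15$: $\{4,5,9,10,14,15,19\}$; - difference $16$: $\{0,4,6,9,10,15,16,19\}$; - difference $17$: $\{0,3,6,10,13,15,16,19\}$; - difference $18$: $\{2,3,4,6,8,13,14,16\}$; - difference $19$: $\{2,3,4,5,9,13,14,15,18,19\}$; - difference $20$: $\{0,3,4,5,6,9,10,13,14,15,16,19\}$.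 Then $A(u,v,w,n)=B(u,v,w,n)$.
   Context: A partition of $n$ is a finite non-increasing sequence of positive integers (parts) with sum $n$. -}

module Defs where

open import Data.Empty using (⊥; ⊥-elim)
open import Data.List using (List; []; _∷_; _++_; map; filter; length)
open import Data.List.Membership.Propositional using (_∈_; _∉_)
open import Data.List.Membership.Propositional.Properties
  using (∈-++⁺ˡ; ∈-++⁺ʳ; ∈-++⁻; ∈-map⁺; ∈-map⁻)
open import Data.List.Relation.Unary.All as All using (All; []; _∷_)
open import Data.List.Relation.Unary.Any using (here; there)
open import Data.List.Relation.Unary.AllPairs using ([]; _∷_)
open import Data.List.Relation.Unary.Linked as Linked using (Linked; []; [-]; _∷_)
open import Data.List.Relation.Unary.Unique.Propositional using (Unique)
open import Data.List.Relation.Unary.Unique.Propositional.Properties using (map⁺; ++⁺)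
open import Data.List.Properties using (∷-injectiveʳ)
open import Data.Nat
open import Data.Nat.DivMod using (_%_)
open import Data.Nat.ListAction using (sum)
open import Data.Nat.Properties
open import Data.Product using (∃; _×_; _,_)
open import Data.Sum using (inj₁; inj₂)
open import Function using (_⇔_; mk⇔)
open import Relation.Binary.PropositionalEquality using (_≡_; refl; sym; trans; cong; subst)
open import Relation.Nullary using (Dec; yes; no; _×-dec_; _→-dec_)
open import Relation.Nullary.Decidable using (map′)
open import Relation.Unary using (Pred; Decidable)

open import Data.List.Membership.DecPropositional _≟_ using (_∈?_; _∉?_)
open import Data.List.Relation.Unary.Unique.DecPropositional _≟_ using (unique?)

record IsPartition (n : ℕ) (ps : List ℕ) : Set where
  field
    nonIncreasing : Linked _≥_ ps
    positive      : All (λ p → 1 ≤ p) ps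
    sum≡          : sum ps ≡ n

-- The partitions of n with at most ℓ parts, all of them at most m.
partitionsWithin : (ℓ m n : ℕ) → List (List ℕ)
partitionsWithin ℓ       m       zero    = [] ∷ []
partitionsWithin zero    m       (suc n) = []
partitionsWithin (suc ℓ) zero    (suc n) = []
partitionsWithin (suc ℓ) (suc m) (suc n) with m ≤? n
... | yes _ = map (suc m ∷_) (partitionsWithin ℓ (suc m) (n ∸ m))
              ++ partitionsWithin (suc ℓ) m (suc n)
... | no  _ = partitionsWithin (suc ℓ) m (suc n)

-- Every partition of n has at most n parts, each at most n; see
-- ∈-partitions and partitions-unique below.
partitions : ℕ → List (List ℕ)
partitions n = partitionsWithin n n n

countPartitions : ∀ {p} {P : Pred (List ℕ) p} → Decidable P → ℕ → ℕ
countPartitions P? n = length (filter P? (partitions n))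

-- The number of parts whose residue modulo m lies in rs.
#parts : List ℕ → (m : ℕ) .{{_ : NonZero m}} → List ℕ → ℕ
#parts ps m rs = length (filter (λ p → (p % m) ∈? rs) ps)

record IsA (u v w : ℕ) (ps : List ℕ) : Set where
  field
    distinct : Unique ps
    residues : All (λ p → p % 10 ∈ 4 ∷ 6 ∷ 9 ∷ []) ps
    count-u  : #parts ps 10 (4 ∷ []) ≡ u
    count-v  : #parts ps 10 (6 ∷ []) ≡ v
    count-w  : #parts ps 10 (9 ∷ []) ≡ w

-- Residues modulo 20 allowed for λᵢ when λᵢ − λᵢ₊₁ is the given difference;
-- only consulted for differences from 9 to 20.
allowedResidues : ℕ → List ℕ
allowedResidues 9  = 4 ∷ 19 ∷ []
allowedResidues 10 = []
allowedResidues 11 = 4 ∷ 6 ∷ 10 ∷ 15 ∷ []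
allowedResidues 12 = 6 ∷ 15 ∷ 16 ∷ []
allowedResidues 13 = 3 ∷ 6 ∷ 9 ∷ 16 ∷ 19 ∷ []
allowedResidues 14 = 4 ∷ 9 ∷ 10 ∷ 13 ∷ 19 ∷ []
allowedResidues 15 = 4 ∷ 5 ∷ 9 ∷ 10 ∷ 14 ∷ 15 ∷ 19 ∷ []
allowedResidues 16 = 0 ∷ 4 ∷ 6 ∷ 9 ∷ 10 ∷ 15 ∷ 16 ∷ 19 ∷ []
allowedResidues 17 = 0 ∷ 3 ∷ 6 ∷ 10 ∷ 13 ∷ 15 ∷ 16 ∷ 19 ∷ []
allowedResidues 18 = 2 ∷ 3 ∷ 4 ∷ 6 ∷ 8 ∷ 13 ∷ 14 ∷ 16 ∷ []
allowedResidues 19 = 2 ∷ 3 ∷ 4 ∷ 5 ∷ 9 ∷ 13 ∷ 14 ∷ 15 ∷ 18 ∷ 19 ∷ []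
allowedResidues 20 = 0 ∷ 3 ∷ 4 ∷ 5 ∷ 6 ∷ 9 ∷ 10 ∷ 13 ∷ 14 ∷ 15 ∷ 16 ∷ 19 ∷ []
allowedResidues _  = []

-- Applied to consecutive parts p ≥ q, so the truncated p ∸ q is the true difference.
GapCondition : ℕ → ℕ → Set
GapCondition p q =
  9 ≤ p ∸ q × (9 ≤ p ∸ q → p ∸ q ≤ 20 → p % 20 ∈ allowedResidues (p ∸ q))

record IsB (u v w : ℕ) (ps : List ℕ) : Set where
  field
    values   : All (_∉ 2 ∷ 3 ∷ 5 ∷ 8 ∷ []) ps
    residues : All (λ p → p % 20 ∉ 1 ∷ 7 ∷ 11 ∷ 12 ∷ 17 ∷ []) ps
    count-u  : u ≡ #parts ps 10 (0 ∷ 3 ∷ 4 ∷ []) + 2 * #parts ps 20 (18 ∷ [])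
    count-v  : v ≡ #parts ps 10 (0 ∷ 5 ∷ 6 ∷ []) + 2 * #parts ps 20 (2 ∷ [])
    count-w  : w ≡ #parts ps 10 (3 ∷ 5 ∷ 9 ∷ []) + 2 * #parts ps 20 (8 ∷ [])
    gaps     : Linked GapCondition ps

isA? : ∀ u v w → Decidable (IsA u v w)
isA? u v w ps = map′
  (λ (a , b , c , d , e) → record
    { distinct = a ; residues = b ; count-u = c ; count-v = d ; count-w = e })
  (λ r → let open IsA r in distinct , residues , count-u , count-v , count-w)
  (unique? ps
    ×-dec All.all? (λ p → (p % 10) ∈? _) ps
    ×-dec (_ ≟ u) ×-dec (_ ≟ v) ×-dec (_ ≟ w))

gapCondition? : ∀ p q → Dec (GapCondition p q)
gapCondition? p q =
  (9 ≤? p ∸ q) ×-dec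
  ((9 ≤? p ∸ q) →-dec ((p ∸ q ≤? 20) →-dec ((p % 20) ∈? allowedResidues (p ∸ q))))

isB? : ∀ u v w → Decidable (IsB u v w)
isB? u v w ps = map′
  (λ (a , b , c , d , e , f) → record
    { values = a ; residues = b ; count-u = c ; count-v = d ; count-w = e ; gaps = f })
  (λ r → let open IsB r in values , residues , count-u , count-v , count-w , gaps)
  (All.all? (_∉? _) ps
    ×-dec All.all? (λ p → (p % 20) ∉? _) ps
    ×-dec (u ≟ _) ×-dec (v ≟ _) ×-dec (w ≟ _)
    ×-dec Linked.linked? gapCondition? ps)

A : (u v w n : ℕ) → ℕ
A u v w = countPartitions (isA? u v w)

B : (u v w n : ℕ) → ℕ
B u v w = countPartitions (isB? u v w)

record Within (ℓ m n : ℕ) (ps : List ℕ) : Set where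
  constructor within
  field
    isPartition : IsPartition n ps
    length≤     : length ps ≤ ℓ
    parts≤      : All (_≤ m) ps

private
  linked-∷ : ∀ {m ps} → All (_≤ m) ps → Linked _≥_ ps → Linked _≥_ (m ∷ ps)
  linked-∷ []      []  = [-]
  linked-∷ (h ∷ _) l   = h ∷ l

  bounded-tail : ∀ {m ps} → Linked _≥_ (m ∷ ps) → All (_≤ m) ps
  bounded-tail [-]     = []
  bounded-tail (h ∷ l) = h ∷ All.map (λ q → ≤-trans q h) (bounded-tail l)

  length≤sum : ∀ {ps} → All (λ p → 1 ≤ p) ps → length ps ≤ sum ps
  length≤sum []       = z≤n
  length≤sum (h ∷ hs) = +-mono-≤ h (length≤sum hs)

  parts≤sum : ∀ ps → All (_≤ sum ps) ps
  parts≤sum []       = []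
  parts≤sum (p ∷ ps) =
    m≤m+n p (sum ps) ∷ All.map (λ q → ≤-trans q (m≤n+m (sum ps) p)) (parts≤sum ps)

  sound : ∀ ℓ m n {ps} → ps ∈ partitionsWithin ℓ m n → Within ℓ m n ps
  sound ℓ m zero (here refl) =
    within (record { nonIncreasing = [] ; positive = [] ; sum≡ = refl }) z≤n []
  sound (suc ℓ) (suc m) (suc n) ps∈ with m ≤? n
  ... | no _ =
    let within p l b = sound (suc ℓ) m (suc n) ps∈
    in within p l (All.map m≤n⇒m≤1+n b)
  ... | yes m≤n with ∈-++⁻ (map (suc m ∷_) (partitionsWithin ℓ (suc m) (n ∸ m))) ps∈
  ...   | inj₂ ps∈′ =
    let within p l b = sound (suc ℓ) m (suc n) ps∈′
    in within p l (All.map m≤n⇒m≤1+n b)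
  ...   | inj₁ ps∈′ with ∈-map⁻ (suc m ∷_) ps∈′
  ...     | qs , qs∈ , refl =
    let within p l b = sound ℓ (suc m) (n ∸ m) qs∈
        open IsPartition p
    in within
         (record
           { nonIncreasing = linked-∷ b nonIncreasing
           ; positive      = s≤s z≤n ∷ positive
           ; sum≡          = cong suc (trans (cong (m +_) sum≡) (m+[n∸m]≡n m≤n)) })
         (s≤s l) (≤-refl ∷ b)

  complete : ∀ ℓ m n {ps} → Within ℓ m n ps → ps ∈ partitionsWithin ℓ m n
  complete ℓ m zero {[]} _ = here refl
  complete ℓ m zero {suc _ ∷ _} (within record { sum≡ = () } _ _)
  complete ℓ m zero {zero ∷ _} (within record { positive = () ∷ _ } _ _)
  complete ℓ m (suc n) {[]} (within record { sum≡ = () } _ _)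
  complete (suc ℓ) zero (suc n) {zero ∷ _} (within record { positive = () ∷ _ } _ _)
  complete (suc ℓ) zero (suc n) {suc _ ∷ _} (within _ _ (() ∷ _))
  complete (suc ℓ) (suc m) (suc n) {p ∷ ps}
    (within part@(record { nonIncreasing = d ; positive = _ ∷ pos ; sum≡ = s }) (s≤s l) (p≤ ∷ b))
    with m ≤? n | p ≟ suc m
  ... | yes _ | yes refl =
    ∈-++⁺ˡ (∈-map⁺ (suc m ∷_) (complete ℓ (suc m) (n ∸ m) (within
      (record
        { nonIncreasing = Linked.tail d
        ; positive      = pos
        ; sum≡          = trans (sym (m+n∸m≡n m (sum ps))) (cong (_∸ m) (suc-injective s)) })
      l b)))
  ... | no m≰n | yes refl =
    ⊥-elim (m≰n (subst (m ≤_) (suc-injective s) (m≤m+n m (sum ps))))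
  ... | yes _ | no p≢ =
    ∈-++⁺ʳ _ (complete (suc ℓ) m (suc n) (within part (s≤s l)
      (let p≤m = s≤s⁻¹ (≤∧≢⇒< p≤ p≢)
       in p≤m ∷ All.map (λ q → ≤-trans q p≤m) (bounded-tail d))))
  ... | no _ | no p≢ =
    complete (suc ℓ) m (suc n) (within part (s≤s l)
      (let p≤m = s≤s⁻¹ (≤∧≢⇒< p≤ p≢)
       in p≤m ∷ All.map (λ q → ≤-trans q p≤m) (bounded-tail d)))

  within-unique : ∀ ℓ m n → Unique (partitionsWithin ℓ m n)
  within-unique ℓ m zero = [] ∷ []
  within-unique zero m (suc n) = []
  within-unique (suc ℓ) zero (suc n) = []
  within-unique (suc ℓ) (suc m) (suc n) with m ≤? n
  ... | no _  = within-unique (suc ℓ) m (suc n)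
  ... | yes _ =
    ++⁺ (map⁺ ∷-injectiveʳ (within-unique ℓ (suc m) (n ∸ m)))
        (within-unique (suc ℓ) m (suc n))
        λ (x∈ , y∈) → disjoint (∈-map⁻ (suc m ∷_) x∈) (sound (suc ℓ) m (suc n) y∈)
    where
    disjoint : ∀ {x} {Q : Pred (List ℕ) _} → (∃ λ qs → Q qs × x ≡ suc m ∷ qs) →
               Within (suc ℓ) m (suc n) x → ⊥
    disjoint (_ , _ , refl) (within _ _ (h ∷ _)) = 1+n≰n h

∈-partitions : ∀ n ps → ps ∈ partitions n ⇔ IsPartition n ps
∈-partitions n ps = mk⇔
  (λ ps∈ → Within.isPartition (sound n n n ps∈))
  (λ p → let open IsPartition p in complete n n n (within p
    (subst (length ps ≤_) sum≡ (length≤sum positive))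
    (subst (λ k → All (_≤ k) ps) sum≡ (parts≤sum ps))))

partitions-unique : ∀ n → Unique (partitions n)
partitions-unique n = within-unique n n n

{-# OPTIONS --safe #-}
module Submission where

-- Give the residues 4, 6, 9 modulo 10 the colours a, b, c and write a part of
-- either kind of partition in terms of colours and heights: primary p k is the
-- part 10k + res p, and secondary p q k is the sum of the primary parts of
-- colour p and height k + ε p q and of colour q and height k, where
-- ε p q is 1 if res p ≤ res q and 0 otherwise.  This ε is the least height
-- difference that makes a primary part of colour p exceed one of colour q, so
-- a secondary part is the sum of two primary parts that are as close as
-- possible.  The residues 4, 6, 9 modulo 10 are those of the primary parts, and
-- the nine kinds of secondary part fill up nine of the remaining residues
-- modulo 20; the excluded values 2, 3, 5, 8 are those whose residue is filled,
-- but only from 22, 23, 25, 28 on.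
--
-- Both sides are refined by the word of colours that they spell, a secondary
-- part spelling two letters; the numbers u, v, w count the letters a, b, c.
-- Fix a word and let δ w be the sum of ε over the adjacent letters of w.  A
-- partition into distinct primary parts that spells the word is a staircase:
-- heights δ (p ∷ w) at each suffix p ∷ w, raised by a weakly decreasing
-- sequence μs.  Pairing off equal entries of μs turns it into a strictly
-- decreasing list xs of entries left single and a weakly decreasing list ms of
-- paired values (Join, unjoin, unjoin-unique).
--
-- On the other side a sequence of primary and secondary parts is a tiling of
-- the word by tiles of one and two letters: a single tile x contributes a
-- primary part raised by x above the staircase, and a pair tile m contributes a
-- secondary part whose two summands are both raised by m.  The sum of all
-- parts depends only on the word and on the multiset of raisings.  The heart
-- of the argument is that the gap condition between consecutive parts says
-- precisely how single and pair tiles are interleaved: among single tiles x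
-- decreases strictly, among pair tiles m decreases weakly, and where the next
-- tile could be either single x or pair m, single x comes first if and only if
-- 2m + δ w < x, where w is the rest of the word after the first letter.
-- (The lemmas gap-ss, gap-sp, gap-ps, gap-pp translate the table of residues
-- into such inequalities, by a finite check.)  Since δ changes by at most one
-- when a letter is dropped, this comparison is monotone, and the local
-- conditions between neighbours are equivalent to the global condition Merged
-- (merged⇒linked, linked⇒merged).  But for every word and every pair of lists
-- xs, ms of fitting length there is exactly one way to interleave under
-- Merged, namely the merge of the two sorted lists (merge, merged-unique).
-- Hence both kinds of partition correspond one to one to triples of a word, a
-- list xs and a list ms, with the same sum and the same letter counts.

open import Defs
open import Data.Bool using (true; false; if_then_else_)
open import Data.Empty using (⊥; ⊥-elim)
open import Data.Fin as Fin using (Fin; toℕ)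
open import Data.Fin.Patterns using (0F; 1F; 2F)
import Data.Fin.Properties as Fin
open import Data.List
  using (List; []; _∷_; _++_; length; filter; lookup; allFin; cartesianProductWith)
open import Data.List.Membership.Propositional using (_∈_; _∉_)
open import Data.List.Membership.Propositional.Properties
  using (∈-++⁺ˡ; ∈-++⁺ʳ; ∈-allFin; ∈-cartesianProductWith⁺; ∈-filter⁺; ∈-filter⁻; ∈-lookup)
open import Data.List.Properties using (∷-injective; ∷-injectiveˡ; ∷-injectiveʳ)
open import Data.List.Relation.Unary.All as All using (All; []; _∷_)
open import Data.List.Relation.Unary.AllPairs as AllPairs using (AllPairs; []; _∷_)
open import Data.List.Relation.Unary.Linked as Linked using (Linked; []; [-]; _∷_)
open import Data.List.Relation.Unary.Linked.Properties using (AllPairs⇒Linked; Linked⇒AllPairs)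
open import Data.List.Relation.Unary.Any as Any using (Any; here; there)
open import Data.List.Relation.Unary.Any.Properties using (lookup-index)
open import Data.List.Relation.Unary.Unique.Propositional using (Unique)
open import Data.List.Relation.Unary.Unique.Propositional.Properties using (filter⁺)
open import Data.Nat
  using (ℕ; zero; suc; _+_; _*_; _∸_; _≤_; _<_; _≥_; _>_; z≤n; s≤s; s≤s⁻¹; _≤ᵇ_; _≡ᵇ_; NonZero)
open import Data.Nat.Divisibility using (divides-refl; ∣n⇒∣m*n)
open import Data.Nat.DivMod using (_%_; _/_; m≡m%n+[m/n]*n; m%n<n; %-remove-+ˡ)
open import Data.Nat.Properties
open import Data.List.Membership.DecPropositional _≟_ using (_∈?_; _∉?_)
open import Data.Nat.ListAction using (sum)
open import Data.Nat.Tactic.RingSolver using (solve-∀)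
open import Data.Product using (∃-syntax; _×_; _,_; proj₁; proj₂)
open import Data.Sum using (_⊎_; inj₁; inj₂; [_,_]′)
open import Function using (_∘_; _⇔_; mk⇔; Equivalence)
open import Level using (0ℓ)
open import Relation.Binary.PropositionalEquality
  using (_≡_; _≢_; refl; sym; trans; cong; cong₂; subst; module ≡-Reasoning)
open import Relation.Nullary using (Dec; yes; no; does; ¬_; contradiction; _×-dec_; _⊎-dec_; ¬?)
open import Relation.Nullary.Decidable using (map′; from-yes)
open import Relation.Unary using (Pred; Decidable)

-- Colours and parts

-- The residue classes modulo 10 of the primary parts.
data Color : Set where
  a b c : Color

-- The residue itself.
res : Color → ℕ
res a = 4
res b = 6
res c = 9

-- The least height difference at which a primary part of colour p is larger than
-- one of colour q; see primary-> below.
ε : Color → Color → ℕ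
ε p q = if res p ≤ᵇ res q then 1 else 0

-- The primary part of colour p and height k.
primary : Color → ℕ → ℕ
primary p k = k * 10 + res p

-- The secondary part with colours p, q and height k: the sum of two primary parts
-- of the least possible height difference.
secondary : Color → Color → ℕ → ℕ
secondary p q k = primary p (k + ε p q) + primary q k

-- The gap condition in terms of heights

-- The class modulo 20 of a part: the colour and the parity of the height for a
-- primary part, the two colours for a secondary part.
data Shape : Set where
  one : Color → Fin 2 → Shape
  two : Color → Color → Shape

-- The least part of a given shape.  It can exceed 20 for a secondary part.
rem : Shape → ℕ
rem (one p i) = toℕ i * 10 + res p
rem (two p q) = secondary p q 0

-- All parts of shape σ; K is half the height, rounded down, for a primary part, and
-- the height for a secondary part.
value : Shape → ℕ → ℕ
value σ K = K * 20 + rem σ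

colors : List Color
colors = a ∷ b ∷ c ∷ []

∈-colors : ∀ p → p ∈ colors
∈-colors a = here refl
∈-colors b = there (here refl)
∈-colors c = there (there (here refl))

ones twos shapes : List Shape
ones   = cartesianProductWith one colors (allFin 2)
twos   = cartesianProductWith two colors colors
shapes = ones ++ twos

∈-shapes : ∀ σ → σ ∈ shapes
∈-shapes (one p i) = ∈-++⁺ˡ (∈-cartesianProductWith⁺ one (∈-colors p) (∈-allFin i))
∈-shapes (two p q) = ∈-++⁺ʳ ones (∈-cartesianProductWith⁺ two (∈-colors p) (∈-colors q))

all-colors? : ∀ {ℓ} {P : Pred Color ℓ} → Decidable P → Dec (∀ p → P p)
all-colors? P? = map′
  (λ h p → All.lookup h (∈-colors p)) (λ h → All.universal h colors) (All.all? P? colors)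

all-shapes? : ∀ {ℓ} {P : Pred Shape ℓ} → Decidable P → Dec (∀ σ → P σ)
all-shapes? P? = map′
  (λ h σ → All.lookup h (∈-shapes σ)) (λ h → All.universal h shapes) (All.all? P? shapes)

-- The gap condition between a part of shape σ and parameter K and one of shape τ
-- and parameter L is the inequality 2L + slackʳ σ τ ≤ 2K + slackˡ σ.
slackˡ : Shape → ℕ
slackˡ (one p i) = toℕ i
slackˡ (two p q) = 0

slackʳ : Shape → Shape → ℕ
slackʳ (one p i) (one q j) = toℕ j + (ε p q + 1)
slackʳ (one p i) (two q r) = ε p q + ε q r * 2 + 1
slackʳ (two p q) (one r j) = toℕ j + ε q r
slackʳ (two p q) (two r s) = (ε q r + ε r s) * 2

-- Logical equivalence of decided propositions, in a form that can be decided by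
-- evaluation.
Iff : Set → Set → Set
Iff P Q = (P × Q) ⊎ (¬ P × ¬ Q)

iff⇒⇔ : ∀ {P Q} → Iff P Q → P ⇔ Q
iff⇒⇔ (inj₁ (x , y)) = mk⇔ (λ _ → y) (λ _ → x)
iff⇒⇔ (inj₂ (x , y)) = mk⇔ (λ p → contradiction p x) (λ q → contradiction q y)

iff? : ∀ {P Q} → Dec P → Dec Q → Dec (Iff P Q)
iff? P? Q? = (P? ×-dec Q?) ⊎-dec (¬? P? ×-dec ¬? Q?)

Gap⇔Bound : Shape → Shape → ℕ → ℕ → Set
Gap⇔Bound σ τ K L = Iff
  (GapCondition (value σ K) (value τ L))
  (L * 2 + slackʳ σ τ ≤ K * 2 + slackˡ σ)

gap⇔bound? : ∀ σ τ K L → Dec (Gap⇔Bound σ τ K L)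
gap⇔bound? σ τ K L = iff?
  (gapCondition? (value σ K) (value τ L))
  (L * 2 + slackʳ σ τ ≤? K * 2 + slackˡ σ)

-- The finite part of gap⇔bound: one of the parameters is 0 and the other at most 2.
table : ∀ σ τ →
  (∀ (K : Fin 3) → Gap⇔Bound σ τ (toℕ K) 0) ×
  (∀ (L : Fin 3) → Gap⇔Bound σ τ 0 (toℕ L))
table = from-yes (all-shapes? λ σ → all-shapes? λ τ →
  Fin.all? (λ (K : Fin 3) → gap⇔bound? σ τ (toℕ K) 0) ×-dec
  Fin.all? (λ (L : Fin 3) → gap⇔bound? σ τ 0 (toℕ L)))

-- Coarse bounds, used when a parameter is at least 3.
ranges : ∀ σ τ → rem σ ≤ 28 × slackˡ σ ≤ 1 × slackʳ σ τ ≤ 4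
ranges = from-yes (all-shapes? λ σ → all-shapes? λ τ →
  (rem σ ≤? 28) ×-dec ((slackˡ σ ≤? 1) ×-dec (slackʳ σ τ ≤? 4)))

-- The gap condition only depends on the difference of the parts and on the larger
-- part modulo 20.
gap-shift : ∀ y z → GapCondition (20 + z) (20 + y) ⇔ GapCondition z y
gap-shift y z = mk⇔
  (λ (g , h) → g , λ l m → subst (_∈ allowedResidues (z ∸ y)) eq (h l m))
  (λ (g , h) → g , λ l m → subst (_∈ allowedResidues (z ∸ y)) (sym eq) (h l m))
  where
  eq : (20 + z) % 20 ≡ z % 20
  eq = %-remove-+ˡ z (divides-refl 1)

-- Both sides are invariant under raising K and L by one, so one of them may be
-- taken to be 0.  If then the other is at least 3, the difference of the parts is
-- out of the range of the table of residues, and both sides have a definite truth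
-- value.
gap⇔bound : ∀ σ τ K L →
  GapCondition (value σ K) (value τ L) ⇔ L * 2 + slackʳ σ τ ≤ K * 2 + slackˡ σ
gap⇔bound σ τ 0 0 = iff⇒⇔ (proj₁ (table σ τ) 0F)
gap⇔bound σ τ 1 0 = iff⇒⇔ (proj₁ (table σ τ) 1F)
gap⇔bound σ τ 2 0 = iff⇒⇔ (proj₁ (table σ τ) 2F)
gap⇔bound σ τ 0 1 = iff⇒⇔ (proj₂ (table σ τ) 1F)
gap⇔bound σ τ 0 2 = iff⇒⇔ (proj₂ (table σ τ) 2F)
gap⇔bound σ τ (suc K) (suc L) = mk⇔
  (s≤s ∘ s≤s ∘ to ∘ Equivalence.to shift)
  (Equivalence.from shift ∘ from ∘ s≤s⁻¹ ∘ s≤s⁻¹)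
  where
  open Equivalence (gap⇔bound σ τ K L)
  shift = gap-shift (value τ L) (value σ K)
gap⇔bound σ τ (suc (suc (suc K))) 0 = mk⇔
  (λ _ → ≤-trans (proj₂ (proj₂ (ranges σ τ))) (≤-trans (m≤m+n 4 (2 + K * 2)) (m≤m+n _ _)))
  (λ _ → ≤-trans (m≤m+n 9 23) big , λ _ small → contradiction (≤-trans big small) (<⇒≱ (m≤m+n 21 11)))
  where
  big : 32 ≤ value σ (3 + K) ∸ rem τ
  big = ∸-mono {60} (≤-trans (m≤m+n 60 (K * 20)) (m≤m+n _ _)) (proj₁ (ranges τ τ))
gap⇔bound σ τ 0 (suc (suc (suc L))) = mk⇔
  (λ (g , _) → contradiction (≤-trans g (≤-reflexive none)) λ ())
  (λ h → contradiction (≤-trans (m≤m+n 6 (L * 2)) (≤-trans (m≤m+n _ _) (≤-trans h (proj₁ (proj₂ (ranges σ τ))))))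
            λ { (s≤s ()) })
  where
  none : rem σ ∸ value τ (3 + L) ≡ 0
  none = m≤n⇒m∸n≡0 (≤-trans (proj₁ (ranges σ τ)) (≤-trans (m≤m+n 28 (32 + L * 20)) (m≤m+n _ _)))

-- A height as twice its half plus its parity.
data Halved : ℕ → Set where
  halved : ∀ K (i : Fin 2) → Halved (K * 2 + toℕ i)

halve : ∀ k → Halved k
halve 0 = halved 0 0F
halve 1 = halved 0 1F
halve (suc (suc k)) with halve k
... | halved K i = halved (suc K) i

primary-value : ∀ p K i → primary p (K * 2 + toℕ i) ≡ value (one p i) K
primary-value p K i = lemma K (toℕ i) (res p)
  where
  lemma : ∀ K i r → (K * 2 + i) * 10 + r ≡ K * 20 + (i * 10 + r)
  lemma = solve-∀

secondary-value : ∀ p q K → secondary p q K ≡ value (two p q) K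
secondary-value p q K = lemma K (res p) (res q) (ε p q)
  where
  lemma : ∀ K r s e → (K + e) * 10 + r + (K * 10 + s) ≡ K * 20 + (e * 10 + r + s)
  lemma = solve-∀

-- Transport of the equivalence along equations for the two parts and the two bounds.
gap-cong : ∀ {y z x w y′ z′ x′ w′} → z ≡ z′ → y ≡ y′ → (GapCondition z′ y′ ⇔ x ≤ w) →
  x ≡ x′ → w ≡ w′ →
  GapCondition z y ⇔ x′ ≤ w′
gap-cong refl refl h refl refl = h

-- The gap condition for the four kinds of neighbours, as an inequality
-- between heights; s stands for a single part that is primary, p for a pair, that
-- is, a secondary part.  Two consecutive primary parts must be further apart than
-- the summands of a secondary part.
gap-ss : ∀ p q k l → GapCondition (primary p k) (primary q l) ⇔ l + (ε p q + 1) ≤ k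
gap-ss p q k l with halve k | halve l
... | halved K i | halved L j =
  gap-cong (primary-value p K i) (primary-value q L j) (gap⇔bound (one p i) (one q j) K L)
    (sym (+-assoc (L * 2) (toℕ j) (ε p q + 1))) refl

gap-sp : ∀ p q r k L → GapCondition (primary p k) (secondary q r L) ⇔ L * 2 + (ε p q + ε q r * 2 + 1) ≤ k
gap-sp p q r k L with halve k
... | halved K i =
  gap-cong (primary-value p K i) (secondary-value q r L) (gap⇔bound (one p i) (two q r) K L) refl refl

gap-ps : ∀ p q r K l → GapCondition (secondary p q K) (primary r l) ⇔ l + ε q r ≤ K * 2
gap-ps p q r K l with halve l
... | halved L j =
  gap-cong (secondary-value p q K) (primary-value r L j) (gap⇔bound (two p q) (one r j) K L)
    (sym (+-assoc (L * 2) (toℕ j) (ε q r))) (+-identityʳ (K * 2))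

gap-pp : ∀ p q r s K L → GapCondition (secondary p q K) (secondary r s L) ⇔ L + (ε q r + ε r s) ≤ K
gap-pp p q r s K L = mk⇔ (*-cancelʳ-≤ _ _ 2 ∘ to) (from ∘ *-monoˡ-≤ 2)
  where
  open Equivalence
    (gap-cong (secondary-value p q K) (secondary-value r s L) (gap⇔bound (two p q) (two r s) K L)
      (sym (*-distribʳ-+ 2 L (ε q r + ε r s))) (+-identityʳ (K * 2)))

-- Parts determine their colours and heights

-- Left inverse of rem modulo 20; the last clause is meant for the residue 8.
shape : ℕ → Shape
shape 4  = one a 0F
shape 14 = one a 1F
shape 6  = one b 0F
shape 16 = one b 1F
shape 9  = one c 0F
shape 19 = one c 1F
shape 18 = two a a
shape 0  = two a b
shape 3  = two a c
shape 10 = two b a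
shape 2  = two b b
shape 5  = two b c
shape 13 = two c a
shape 15 = two c b
shape _  = two c c

shape-rem : ∀ σ → shape (rem σ % 20) ≡ σ
shape-rem (one a 0F) = refl
shape-rem (one a 1F) = refl
shape-rem (one b 0F) = refl
shape-rem (one b 1F) = refl
shape-rem (one c 0F) = refl
shape-rem (one c 1F) = refl
shape-rem (two a a)  = refl
shape-rem (two a b)  = refl
shape-rem (two a c)  = refl
shape-rem (two b a)  = refl
shape-rem (two b b)  = refl
shape-rem (two b c)  = refl
shape-rem (two c a)  = refl
shape-rem (two c b)  = refl
shape-rem (two c c)  = refl

value-%20 : ∀ σ K → value σ K % 20 ≡ rem σ % 20
value-%20 σ K = %-remove-+ˡ (rem σ) (divides-refl K)

value-%10 : ∀ σ K → value σ K % 10 ≡ rem σ % 10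
value-%10 σ K = %-remove-+ˡ (rem σ) (∣n⇒∣m*n K (divides-refl 2))

primary-%10 : ∀ p k → primary p k % 10 ≡ res p
primary-%10 p k = trans (%-remove-+ˡ (res p) (divides-refl k)) (res-%10 p)
  where
  res-%10 : ∀ p → res p % 10 ≡ res p
  res-%10 = from-yes (all-colors? λ p → res p % 10 ≟ res p)

value-injective : ∀ σ τ K L → value σ K ≡ value τ L → σ ≡ τ × K ≡ L
value-injective σ τ K L eq with σ≡τ
  where
  open ≡-Reasoning
  σ≡τ : σ ≡ τ
  σ≡τ = begin
    σ                       ≡⟨ shape-rem σ ⟨
    shape (rem σ % 20)      ≡⟨ cong shape (value-%20 σ K) ⟨
    shape (value σ K % 20)  ≡⟨ cong (λ z → shape (z % 20)) eq ⟩
    shape (value τ L % 20)  ≡⟨ cong shape (value-%20 τ L) ⟩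
    shape (rem τ % 20)      ≡⟨ shape-rem τ ⟩
    τ                       ∎
... | refl = refl , *-cancelʳ-≡ K L 20 (+-cancelʳ-≡ (rem σ) _ _ eq)

-- The case of primary-injective in which halves and parities are given.
halved-injective : ∀ p q K L i j →
  primary p (K * 2 + toℕ i) ≡ primary q (L * 2 + toℕ j) → p ≡ q × K * 2 + toℕ i ≡ L * 2 + toℕ j
halved-injective p q K L i j eq = components
  (value-injective (one p i) (one q j) K L
    (trans (sym (primary-value p K i)) (trans eq (primary-value q L j))))
  where
  components : one p i ≡ one q j × K ≡ L → p ≡ q × K * 2 + toℕ i ≡ L * 2 + toℕ j
  components (refl , refl) = refl , refl

primary-injective : ∀ p q k l → primary p k ≡ primary q l → p ≡ q × k ≡ l
primary-injective p q k l eq with halve k | halve l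
... | halved K i | halved L j = halved-injective p q K L i j eq

secondary-injective : ∀ p q r s K L → secondary p q K ≡ secondary r s L → p ≡ r × q ≡ s × K ≡ L
secondary-injective p q r s K L eq = components
  (value-injective (two p q) (two r s) K L
    (trans (sym (secondary-value p q K)) (trans eq (secondary-value r s L))))
  where
  components : two p q ≡ two r s × K ≡ L → p ≡ r × q ≡ s × K ≡ L
  components (refl , refl) = refl , refl , refl

primary≢secondary : ∀ p q r k L → primary p k ≢ secondary q r L
primary≢secondary p q r k L eq with halve k
... | halved K i = distinct (proj₁ (value-injective (one p i) (two q r) K L
  (trans (sym (primary-value p K i)) (trans eq (secondary-value q r L)))))
  where
  distinct : one p i ≢ two q r
  distinct ()

-- Words, tiles and the merging condition

-- The height of the lowest staircase that spells a word: the sum of ε over its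
-- adjacent letters.
δ : List Color → ℕ
δ []          = 0
δ (p ∷ [])    = 0
δ (p ∷ q ∷ w) = ε p q + δ (q ∷ w)

ε≤1 : ∀ p q → ε p q ≤ 1
ε≤1 p q with res p ≤ᵇ res q
... | true  = ≤-refl
... | false = z≤n

δ-grows : ∀ p w → δ w ≤ δ (p ∷ w)
δ-grows p []      = z≤n
δ-grows p (q ∷ w) = m≤n+m _ (ε p q)

δ-slow : ∀ p w → δ (p ∷ w) ≤ suc (δ w)
δ-slow p []      = z≤n
δ-slow p (q ∷ w) = +-monoˡ-≤ _ (ε≤1 p q)

-- A tile covers one or two letters of a word.  The number is the amount by which
-- its primary summands are raised above the staircase.
data Tile : Set where
  single : Color → ℕ → Tile
  pair   : Color → Color → ℕ → Tile

-- The word covered by a list of tiles.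
word : List Tile → List Color
word []                = []
word (single p x ∷ ts) = p ∷ word ts
word (pair p q m ∷ ts) = p ∷ q ∷ word ts

-- The amounts on the tiles of one letter, and on the tiles of two letters.
singles pairs : List Tile → List ℕ
singles []                = []
singles (single p x ∷ ts) = x ∷ singles ts
singles (pair p q m ∷ ts) = singles ts

pairs []                = []
pairs (single p x ∷ ts) = pairs ts
pairs (pair p q m ∷ ts) = m ∷ pairs ts

-- The parts that the tiles stand for.  In a pair tile both summands are raised by m:
-- the first then has height m + δ (p ∷ q ∷ w) = (m + δ (q ∷ w)) + ε p q.
parts : List Tile → List ℕ
parts []                = []
parts (single p x ∷ ts) = primary p (x + δ (p ∷ word ts)) ∷ parts ts
parts (pair p q m ∷ ts) = secondary p q (m + δ (q ∷ word ts)) ∷ parts ts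

-- Every tile is in the right order with respect to all later tiles, not just the
-- next one: the singles decrease strictly, the pairs decrease weakly, and a single
-- tile x comes before a pair tile m if and only if 2m + δ w < x, where w is the
-- word without its first letter at the point where either could come next.
data Merged : List Tile → Set where
  []     : Merged []
  single : ∀ {p x ts} →
    All (_< x) (singles ts) →
    All (λ m → m * 2 + δ (word ts) < x) (pairs ts) →
    Merged ts → Merged (single p x ∷ ts)
  pair   : ∀ {p q m ts} →
    All (λ x → x ≤ m * 2 + δ (q ∷ word ts)) (singles ts) →
    All (_≤ m) (pairs ts) →
    Merged ts → Merged (pair p q m ∷ ts)

-- For a tile placed in front of a merged list it is enough to compare it with the
-- first tile of the list.  There are four cases, according to the kinds of the
-- two tiles.
cons-ss : ∀ {p q x y ts} → y < x → Merged (single q y ∷ ts) → Merged (single p x ∷ single q y ∷ ts)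
cons-ss {q = q} {ts = ts} y<x M@(single lt ahead _) = single
  (y<x ∷ All.map (λ z<y → <-trans z<y y<x) lt)
  (All.map (λ {m} h → ≤-<-trans
     (≤-trans (+-monoʳ-≤ (m * 2) (δ-slow q (word ts))) (≤-trans (≤-reflexive (+-suc _ _)) h))
     y<x) ahead)
  M

cons-sp : ∀ {p q r x m ts} → m * 2 + δ (q ∷ r ∷ word ts) < x →
  Merged (pair q r m ∷ ts) → Merged (single p x ∷ pair q r m ∷ ts)
cons-sp {q = q} {r} {m = m} {ts} m<x M@(pair behind le _) = single
  (All.map (λ h → ≤-<-trans (≤-trans h (+-monoʳ-≤ (m * 2) (δ-grows q (r ∷ word ts)))) m<x) behind)
  (m<x ∷ All.map (λ m′≤m → ≤-<-trans (+-monoˡ-≤ _ (*-monoˡ-≤ 2 m′≤m)) m<x) le)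
  M

cons-ps : ∀ {p q r m x ts} → x ≤ m * 2 + δ (q ∷ r ∷ word ts) →
  Merged (single r x ∷ ts) → Merged (pair p q m ∷ single r x ∷ ts)
cons-ps {q = q} {r} {m} {x} {ts} x≤m M@(single lt ahead _) = pair
  (x≤m ∷ All.map (λ z<x → ≤-trans (<⇒≤ z<x) x≤m) lt)
  -- The two extra letters raise δ by at most 2, and 2m′ < 2m + 2 implies m′ ≤ m.
  (All.map (λ {m′} h → s≤s⁻¹ (*-cancelʳ-< 2 m′ (suc m)
     (+-cancelʳ-< (δ (word ts)) (m′ * 2) (suc m * 2) (begin-strict
       m′ * 2 + δ (word ts)          <⟨ h ⟩
       x                             ≤⟨ x≤m ⟩
       m * 2 + δ (q ∷ r ∷ word ts)   ≤⟨ +-monoʳ-≤ (m * 2)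
                                         (≤-trans (δ-slow q (r ∷ word ts)) (s≤s (δ-slow r (word ts)))) ⟩
       m * 2 + (2 + δ (word ts))     ≡⟨ +-assoc (m * 2) 2 _ ⟨
       m * 2 + 2 + δ (word ts)       ≡⟨ cong (_+ δ (word ts)) (+-comm (m * 2) 2) ⟩
       suc m * 2 + δ (word ts)       ∎)))) ahead)
  M
  where open ≤-Reasoning

cons-pp : ∀ {p q r s m n ts} → n ≤ m → Merged (pair r s n ∷ ts) → Merged (pair p q m ∷ pair r s n ∷ ts)
cons-pp {q = q} {r} {s} {ts = ts} n≤m M@(pair behind le _) = pair
  (All.map (λ h → ≤-trans h (+-mono-≤ (*-monoˡ-≤ 2 n≤m)
     (≤-trans (δ-grows r (s ∷ word ts)) (δ-grows q (r ∷ s ∷ word ts))))) behind)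
  (n≤m ∷ All.map (λ h → ≤-trans h n≤m) le)
  M

-- The gap condition is the merging condition

-- Cancellation of a common summand in the bound of an equivalence.
shift⇔ : ∀ {P : Set} {l k u v t} → P ⇔ l ≤ k → l ≡ u + t → k ≡ v + t → P ⇔ u ≤ v
shift⇔ {t = t} P⇔ refl refl = mk⇔
  (+-cancelʳ-≤ t _ _ ∘ Equivalence.to P⇔)
  (Equivalence.from P⇔ ∘ +-monoˡ-≤ t)

-- The gap conditions for parts given by tiles at the front of a word: the heights
-- of the staircase cancel, and what remains is the order required by Merged.
gap-ss′ : ∀ p q w x y →
  GapCondition (primary p (x + δ (p ∷ q ∷ w))) (primary q (y + δ (q ∷ w))) ⇔ y < x
gap-ss′ p q w x y = shift⇔ (gap-ss p q _ (y + δ (q ∷ w))) (lemma y (δ (q ∷ w)) (ε p q)) refl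
  where
  lemma : ∀ y d e → y + d + (e + 1) ≡ 1 + y + (e + d)
  lemma = solve-∀

gap-sp′ : ∀ p q r w x m →
  GapCondition (primary p (x + δ (p ∷ q ∷ r ∷ w))) (secondary q r (m + δ (r ∷ w)))
    ⇔ m * 2 + δ (q ∷ r ∷ w) < x
gap-sp′ p q r w x m =
  shift⇔ (gap-sp p q r _ (m + δ (r ∷ w))) (lemma m (δ (r ∷ w)) (ε p q) (ε q r)) refl
  where
  lemma : ∀ m d e f → (m + d) * 2 + (e + f * 2 + 1) ≡ 1 + (m * 2 + (f + d)) + (e + (f + d))
  lemma = solve-∀

gap-ps′ : ∀ p q r w m x →
  GapCondition (secondary p q (m + δ (q ∷ r ∷ w))) (primary r (x + δ (r ∷ w)))
    ⇔ x ≤ m * 2 + δ (q ∷ r ∷ w)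
gap-ps′ p q r w m x =
  shift⇔ (gap-ps p q r (m + δ (q ∷ r ∷ w)) _) (lemmaˡ x (δ (r ∷ w)) (ε q r)) (lemmaʳ m (δ (q ∷ r ∷ w)))
  where
  lemmaˡ : ∀ x d e → x + d + e ≡ x + (e + d)
  lemmaˡ = solve-∀
  lemmaʳ : ∀ m d → (m + d) * 2 ≡ m * 2 + d + d
  lemmaʳ = solve-∀

gap-pp′ : ∀ p q r s w m n →
  GapCondition (secondary p q (m + δ (q ∷ r ∷ s ∷ w))) (secondary r s (n + δ (s ∷ w)))
    ⇔ n ≤ m
gap-pp′ p q r s w m n =
  shift⇔ (gap-pp p q r s (m + δ (q ∷ r ∷ s ∷ w)) (n + δ (s ∷ w))) (lemma n (δ (s ∷ w)) (ε q r) (ε r s)) refl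
  where
  lemma : ∀ n d e f → n + d + (e + f) ≡ n + (e + (f + d))
  lemma = solve-∀

merged⇒linked : ∀ {ts} → Merged ts → Linked GapCondition (parts ts)
merged⇒linked [] = []
merged⇒linked {single p x ∷ []} _ = [-]
merged⇒linked {single p x ∷ single q y ∷ ts} (single (y<x ∷ _) _ M) =
  Equivalence.from (gap-ss′ p q (word ts) x y) y<x ∷ merged⇒linked M
merged⇒linked {single p x ∷ pair q r m ∷ ts} (single _ (m<x ∷ _) M) =
  Equivalence.from (gap-sp′ p q r (word ts) x m) m<x ∷ merged⇒linked M
merged⇒linked {pair p q m ∷ []} _ = [-]
merged⇒linked {pair p q m ∷ single r x ∷ ts} (pair (x≤m ∷ _) _ M) =
  Equivalence.from (gap-ps′ p q r (word ts) m x) x≤m ∷ merged⇒linked M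
merged⇒linked {pair p q m ∷ pair r s n ∷ ts} (pair _ (n≤m ∷ _) M) =
  Equivalence.from (gap-pp′ p q r s (word ts) m n) n≤m ∷ merged⇒linked M

-- The lower bound on single amounts needed to show that no pair amount in front of
-- them is negative.
δ≤single : ∀ {p x ts} → Merged (single p x ∷ ts) → δ (p ∷ word ts) ≤ x
δ≤single {ts = []} _ = z≤n
δ≤single {p} {ts = single q y ∷ ts} (single (y<x ∷ _) _ M) =
  ≤-trans (δ-slow p (q ∷ word ts)) (≤-trans (s≤s (δ≤single M)) y<x)
δ≤single {p} {ts = pair q r m ∷ ts} (single _ (m<x ∷ _) _) =
  ≤-trans (δ-slow p (q ∷ r ∷ word ts)) (≤-trans (s≤s (m≤n+m _ (m * 2))) m<x)

-- The gap condition keeps parts above the staircase, so that the amount on the new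
-- tile is a natural number.
primary-δ≤ : ∀ p k {ts} → Linked GapCondition (primary p k ∷ parts ts) → δ (p ∷ word ts) ≤ k
primary-δ≤ p k {[]} _ = z≤n
primary-δ≤ p k {single q y ∷ ts} (g ∷ _) =
  ≤-trans (≤-trans (m≤m+n _ (y + 1)) (≤-reflexive (lemma (ε p q) (δ (q ∷ word ts)) y)))
    (Equivalence.to (gap-ss p q k (y + δ (q ∷ word ts))) g)
  where
  lemma : ∀ e d y → e + d + (y + 1) ≡ y + d + (e + 1)
  lemma = solve-∀
primary-δ≤ p k {pair q r m ∷ ts} (g ∷ _) =
  ≤-trans (≤-trans (m≤m+n _ (m * 2 + (d + (ε q r + 1)))) (≤-reflexive (lemma (ε p q) (ε q r) d m)))
    (Equivalence.to (gap-sp p q r k (m + d)) g)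
  where
  d = δ (r ∷ word ts)
  lemma : ∀ e f d m → e + (f + d) + (m * 2 + (d + (f + 1))) ≡ (m + d) * 2 + (e + f * 2 + 1)
  lemma = solve-∀

secondary-δ≤ : ∀ p q K {ts} → Merged ts → Linked GapCondition (secondary p q K ∷ parts ts) →
  δ (q ∷ word ts) ≤ K
secondary-δ≤ p q K {[]} _ _ = z≤n
-- With D = δ (q ∷ r ∷ word ts), the bounds D ≤ x + 1 and x + D ≤ 2K give
-- 2D < 2 (K + 1).
secondary-δ≤ p q K {single r x ∷ ts} M (g ∷ _) = s≤s⁻¹ (*-cancelʳ-< 2 D (suc K) (begin-strict
    D * 2                                ≡⟨ lemma₁ D ⟩
    D + D                                ≤⟨ +-monoˡ-≤ D (≤-trans (δ-slow q (r ∷ word ts)) (s≤s (δ≤single M))) ⟩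
    1 + x + D                            ≡⟨ lemma₂ x (δ (r ∷ word ts)) (ε q r) ⟩
    1 + (x + δ (r ∷ word ts) + ε q r)    ≤⟨ s≤s (Equivalence.to (gap-ps p q r K (x + δ (r ∷ word ts))) g) ⟩
    1 + K * 2                            <⟨ ≤-refl ⟩
    suc K * 2                            ∎))
  where
  open ≤-Reasoning
  D = δ (q ∷ r ∷ word ts)
  lemma₁ : ∀ D → D * 2 ≡ D + D
  lemma₁ = solve-∀
  lemma₂ : ∀ x d e → 1 + x + (e + d) ≡ 1 + (x + d + e)
  lemma₂ = solve-∀
secondary-δ≤ p q K {pair r s m ∷ ts} _ (g ∷ _) =
  ≤-trans (≤-trans (m≤n+m _ m) (≤-reflexive (lemma m (ε q r) (ε r s) (δ (s ∷ word ts)))))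
    (Equivalence.to (gap-pp p q r s K (m + δ (s ∷ word ts))) g)
  where
  lemma : ∀ m e f d → m + (e + (f + d)) ≡ m + d + (e + f)
  lemma = solve-∀

-- The gap condition at the front makes the new tile merged with the rest.
cons-single : ∀ p x {ts} → Merged ts →
  Linked GapCondition (parts (single p x ∷ ts)) → Merged (single p x ∷ ts)
cons-single p x {[]}              M _       = single [] [] M
cons-single p x {single q y ∷ ts} M (g ∷ _) =
  cons-ss (Equivalence.to (gap-ss′ p q (word ts) x y) g) M
cons-single p x {pair q r m ∷ ts} M (g ∷ _) =
  cons-sp (Equivalence.to (gap-sp′ p q r (word ts) x m) g) M

cons-pair : ∀ p q m {ts} → Merged ts →
  Linked GapCondition (parts (pair p q m ∷ ts)) → Merged (pair p q m ∷ ts)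
cons-pair p q m {[]}              M _       = pair [] [] M
cons-pair p q m {single r x ∷ ts} M (g ∷ _) =
  cons-ps (Equivalence.to (gap-ps′ p q r (word ts) m x) g) M
cons-pair p q m {pair r s n ∷ ts} M (g ∷ _) =
  cons-pp (Equivalence.to (gap-pp′ p q r s (word ts) m n) g) M

-- Parts that are primary or secondary.
data Admissible : ℕ → Set where
  isPrimary   : ∀ p k → Admissible (primary p k)
  isSecondary : ∀ p q k → Admissible (secondary p q k)

linked⇒merged : ∀ {zs} → All Admissible zs → Linked GapCondition zs →
  ∃[ ts ] Merged ts × parts ts ≡ zs
linked⇒merged [] _ = [] , [] , refl
linked⇒merged {z ∷ _} (h ∷ hs) l with linked⇒merged hs (Linked.tail l)
linked⇒merged (isPrimary p k ∷ _) l | ts , M , refl =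
  single p (k ∸ D) ∷ ts , cons-single p (k ∸ D) M
      (subst (λ z → Linked GapCondition (z ∷ parts ts)) (sym eq) l)
  , cong (_∷ parts ts) eq
  where
  D = δ (p ∷ word ts)
  eq : primary p (k ∸ D + D) ≡ primary p k
  eq = cong (primary p) (m∸n+n≡m (primary-δ≤ p k l))
linked⇒merged (isSecondary p q k ∷ _) l | ts , M , refl =
  pair p q (k ∸ D) ∷ ts , cons-pair p q (k ∸ D) M
      (subst (λ z → Linked GapCondition (z ∷ parts ts)) (sym eq) l)
  , cong (_∷ parts ts) eq
  where
  D = δ (q ∷ word ts)
  eq : secondary p q (k ∸ D + D) ≡ secondary p q k
  eq = cong (secondary p q) (m∸n+n≡m (secondary-δ≤ p q k M l))

-- Existence and uniqueness of the merge

-- The interleavings of the lists xs and ms along the word w.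
Merge : List Color → List ℕ → List ℕ → Set
Merge w xs ms = ∃[ ts ] Merged ts × word ts ≡ w × singles ts ≡ xs × pairs ts ≡ ms

put-single : ∀ {w xs ms} p {x} → All (_< x) xs → All (λ m → m * 2 + δ w < x) ms →
  Merge w xs ms → Merge (p ∷ w) (x ∷ xs) ms
put-single p lt ahead (ts , M , refl , refl , refl) =
  single p _ ∷ ts , single lt ahead M , refl , refl , refl

put-pair : ∀ {w xs ms} p q {m} → All (λ x → x ≤ m * 2 + δ (q ∷ w)) xs → All (_≤ m) ms →
  Merge w xs ms → Merge (p ∷ q ∷ w) xs (m ∷ ms)
put-pair p q behind le (ts , M , refl , refl , refl) =
  pair p q _ ∷ ts , pair behind le M , refl , refl , refl

-- The usual merge of two sorted lists: at each step the comparison of the first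
-- entries decides which kind of tile comes next.
merge : ∀ w xs ms → AllPairs _>_ xs → AllPairs _≥_ ms → length w ≡ length xs + length ms * 2 →
  Merge w xs ms
merge []          []       []       _           _           _  = [] , [] , refl , refl , refl
merge []          (_ ∷ _)  _        _           _           ()
merge []          []       (_ ∷ _)  _           _           ()
merge (p ∷ w)     []       []       _           _           ()
merge (p ∷ w)     (x ∷ xs) []       (x> ∷ xs>)  ms≥         eq =
  put-single p x> [] (merge w xs [] xs> ms≥ (suc-injective eq))
merge (p ∷ [])    []       (m ∷ ms) _           _           ()
merge (p ∷ q ∷ w) []       (m ∷ ms) xs>         (m≥ ∷ ms≥)  eq =
  put-pair p q [] m≥ (merge w [] ms xs> ms≥ (suc-injective (suc-injective eq)))
merge (p ∷ [])    (x ∷ xs) (m ∷ ms) _           _           eq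
  with () ← trans (suc-injective eq) (+-suc (length xs) _)
merge (p ∷ q ∷ w) (x ∷ xs) (m ∷ ms) (x> ∷ xs>)  (m≥ ∷ ms≥)  eq =
  [ (λ x≤ → put-pair p q (x≤ ∷ All.map (λ y<x → ≤-trans (<⇒≤ y<x) x≤) x>) m≥
              (merge w (x ∷ xs) ms (x> ∷ xs>) ms≥
                (suc-injective (suc-injective (trans eq (lemma (length xs) (length ms)))))))
  , (λ <x → put-single p x>
              (<x ∷ All.map (λ m′≤m → ≤-<-trans (+-monoˡ-≤ _ (*-monoˡ-≤ 2 m′≤m)) <x) m≥)
              (merge (q ∷ w) xs (m ∷ ms) xs> (m≥ ∷ ms≥) (suc-injective eq)))
  ]′ (≤-<-connex x (m * 2 + δ (q ∷ w)))
  where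
  lemma : ∀ i j → 1 + i + (1 + j) * 2 ≡ 2 + (1 + i + j * 2)
  lemma = solve-∀

-- At the same point of a word, the next tile cannot be a single tile in one merged
-- list and a pair tile in another one with the same remaining amounts.
single-or-pair : ∀ {w w′ x m xs xs′ ms ms′} → w ≡ w′ → x ∷ xs ≡ xs′ → ms ≡ m ∷ ms′ →
  All (λ m → m * 2 + δ w < x) ms → All (λ x → x ≤ m * 2 + δ w′) xs′ → ⊥
single-or-pair refl refl refl (m<x ∷ _) (x≤m ∷ _) = <⇒≱ m<x x≤m

merged-unique : ∀ {ts ts′} → Merged ts → Merged ts′ →
  word ts ≡ word ts′ → singles ts ≡ singles ts′ → pairs ts ≡ pairs ts′ → ts ≡ ts′
merged-unique [] [] _ _ _ = refl
merged-unique [] (single _ _ _) () _ _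
merged-unique [] (pair _ _ _) () _ _
merged-unique (single _ _ _) [] () _ _
merged-unique (pair _ _ _) [] () _ _
merged-unique (single _ _ M) (single _ _ M′) eq-w eq-xs eq-ms
  with refl , eq-w′ ← ∷-injective eq-w | refl , eq-xs′ ← ∷-injective eq-xs =
  cong (_ ∷_) (merged-unique M M′ eq-w′ eq-xs′ eq-ms)
merged-unique (pair _ _ M) (pair _ _ M′) eq-w eq-xs eq-ms
  with refl , eq-w′ ← ∷-injective eq-w | refl , eq-ms′ ← ∷-injective eq-ms
  with refl , eq-w″ ← ∷-injective eq-w′ =
  cong (_ ∷_) (merged-unique M M′ eq-w″ eq-xs eq-ms′)
merged-unique (single _ ahead _) (pair behind _ _) eq-w eq-xs eq-ms =
  ⊥-elim (single-or-pair (proj₂ (∷-injective eq-w)) eq-xs eq-ms ahead behind)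
merged-unique (pair behind _ _) (single _ ahead _) eq-w eq-xs eq-ms =
  ⊥-elim (single-or-pair (proj₂ (∷-injective (sym eq-w))) (sym eq-xs) (sym eq-ms) ahead behind)

-- Tiles are determined by their parts

parts-injective : ∀ ts ts′ → parts ts ≡ parts ts′ → ts ≡ ts′
parts-injective []                []                 _  = refl
parts-injective []                (single _ _ ∷ _)   ()
parts-injective []                (pair _ _ _ ∷ _)   ()
parts-injective (single _ _ ∷ _)  []                 ()
parts-injective (pair _ _ _ ∷ _)  []                 ()
parts-injective (single p x ∷ ts) (single q y ∷ ts′) eq = same
  (parts-injective ts ts′ (∷-injectiveʳ eq))
  (primary-injective p q (x + δ (p ∷ word ts)) (y + δ (q ∷ word ts′)) (∷-injectiveˡ eq))
  where
  same : ts ≡ ts′ → p ≡ q × x + δ (p ∷ word ts) ≡ y + δ (q ∷ word ts′) →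
    single p x ∷ ts ≡ single q y ∷ ts′
  same refl (refl , e) = cong (λ x → single p x ∷ ts) (+-cancelʳ-≡ (δ (p ∷ word ts)) x y e)
parts-injective (pair p q m ∷ ts) (pair r s n ∷ ts′) eq = same
  (parts-injective ts ts′ (∷-injectiveʳ eq))
  (secondary-injective p q r s (m + δ (q ∷ word ts)) (n + δ (s ∷ word ts′)) (∷-injectiveˡ eq))
  where
  same : ts ≡ ts′ → p ≡ r × q ≡ s × m + δ (q ∷ word ts) ≡ n + δ (s ∷ word ts′) →
    pair p q m ∷ ts ≡ pair r s n ∷ ts′
  same refl (refl , refl , e) = cong (λ m → pair p q m ∷ ts) (+-cancelʳ-≡ (δ (q ∷ word ts)) m n e)
parts-injective (single p x ∷ ts) (pair q r m ∷ ts′) eq =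
  ⊥-elim (primary≢secondary p q r (x + δ (p ∷ word ts)) (m + δ (r ∷ word ts′)) (∷-injectiveˡ eq))
parts-injective (pair q r m ∷ ts) (single p x ∷ ts′) eq =
  ⊥-elim (primary≢secondary p q r (x + δ (p ∷ word ts′)) (m + δ (r ∷ word ts)) (sym (∷-injectiveˡ eq)))

-- Pairing off equal entries

-- Join xs ms μs: the list μs is obtained by merging xs with two copies of each
-- entry of ms.  Since xs decreases strictly and ms decreases weakly, μs decreases
-- weakly, and xs and ms can be recovered from it by pairing off equal entries.  In
-- a tie between the two lists the single entry comes first.
data Join : List ℕ → List ℕ → List ℕ → Set where
  []     : Join [] [] []
  single : ∀ {x xs ms μs} → All (_< x) xs → All (_≤ x) ms →
    Join xs ms μs → Join (x ∷ xs) ms (x ∷ μs)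
  pair   : ∀ {m xs ms μs} → All (_< m) xs → All (_≤ m) ms →
    Join xs ms μs → Join xs (m ∷ ms) (m ∷ m ∷ μs)

All-join⁺ : ∀ {P : Pred ℕ 0ℓ} {xs ms μs} → Join xs ms μs → All P xs → All P ms → All P μs
All-join⁺ []             _          _          = []
All-join⁺ (single _ _ J) (px ∷ pxs) pms        = px ∷ All-join⁺ J pxs pms
All-join⁺ (pair _ _ J)   pxs        (pm ∷ pms) = pm ∷ pm ∷ All-join⁺ J pxs pms

All-join⁻ : ∀ {P : Pred ℕ 0ℓ} {xs ms μs} → Join xs ms μs → All P μs → All P xs × All P ms
All-join⁻ []             _            = [] , []
All-join⁻ (single _ _ J) (p ∷ ps)     with pxs , pms ← All-join⁻ J ps = p ∷ pxs , pms
All-join⁻ (pair _ _ J)   (p ∷ _ ∷ ps) with pxs , pms ← All-join⁻ J ps = pxs , p ∷ pms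

join-sorted : ∀ {xs ms μs} → Join xs ms μs → AllPairs _≥_ μs
join-sorted []               = []
join-sorted (single lt le J) = All-join⁺ J (All.map <⇒≤ lt) le ∷ join-sorted J
join-sorted (pair lt le J)   = (≤-refl ∷ m≥) ∷ m≥ ∷ join-sorted J
  where m≥ = All-join⁺ J (All.map <⇒≤ lt) le

singles-sorted : ∀ {xs ms μs} → Join xs ms μs → AllPairs _>_ xs
singles-sorted []              = []
singles-sorted (single lt _ J) = lt ∷ singles-sorted J
singles-sorted (pair _ _ J)    = singles-sorted J

pairs-sorted : ∀ {xs ms μs} → Join xs ms μs → AllPairs _≥_ ms
pairs-sorted []             = []
pairs-sorted (single _ _ J) = pairs-sorted J
pairs-sorted (pair _ le J)  = le ∷ pairs-sorted J

sum-join : ∀ {xs ms μs} → Join xs ms μs → sum μs ≡ sum xs + sum ms * 2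
sum-join []                 = refl
sum-join (single {x} _ _ J) = trans (cong (x +_) (sum-join J)) (sym (+-assoc x _ _))
sum-join (pair {m} {xs} {ms} _ _ J) =
  trans (cong (λ s → m + (m + s)) (sum-join J)) (lemma m (sum xs) (sum ms))
  where
  lemma : ∀ m x s → m + (m + (x + s * 2)) ≡ x + (m + s) * 2
  lemma = solve-∀

length-join : ∀ {xs ms μs} → Join xs ms μs → length μs ≡ length xs + length ms * 2
length-join []             = refl
length-join (single _ _ J) = cong suc (length-join J)
length-join (pair {m} {xs} {ms} _ _ J) =
  trans (cong (suc ∘ suc) (length-join J)) (lemma (length xs) (length ms))
  where
  lemma : ∀ i j → 2 + (i + j * 2) ≡ i + (1 + j) * 2
  lemma = solve-∀

join : ∀ {xs ms} → AllPairs _>_ xs → AllPairs _≥_ ms → ∃[ μs ] Join xs ms μs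
join []         []         = _ , []
join (x> ∷ xs>) []         = _ , single x> [] (proj₂ (join xs> []))
join []         (m≥ ∷ ms≥) = _ , pair [] m≥ (proj₂ (join [] ms≥))
join {x ∷ _} {m ∷ _} (x> ∷ xs>) (m≥ ∷ ms≥) =
  [ (λ m≤x → _ , single x> (m≤x ∷ All.map (λ h → ≤-trans h m≤x) m≥) (proj₂ (join xs> (m≥ ∷ ms≥))))
  , (λ x<m → _ , pair (x<m ∷ All.map (λ h → <-trans h x<m) x>) m≥ (proj₂ (join (x> ∷ xs>) ms≥)))
  ]′ (≤-<-connex m x)

-- A new largest entry is paired with the first single entry if the two are equal,
-- and is left single otherwise.
join-∷ : ∀ {xs ms μs} m → All (_≤ m) xs → All (_≤ m) ms → Join xs ms μs →
  ∃[ xs′ ] ∃[ ms′ ] Join xs′ ms′ (m ∷ μs)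
join-∷ m _ _ [] = m ∷ [] , [] , single [] [] []
join-∷ m (x≤m ∷ _) ms≤m J@(single {x} lt le J′) with m ≟ x
... | yes refl = _ , _ , pair lt le J′
... | no m≢x   = _ , _ , single (x<m ∷ All.map (λ h → <-trans h x<m) lt) ms≤m J
  where x<m = ≤∧≢⇒< x≤m (m≢x ∘ sym)
join-∷ m _ ms≤m@(n≤m ∷ _) J@(pair lt _ _) =
  _ , _ , single (All.map (λ h → <-≤-trans h n≤m) lt) ms≤m J

unjoin : ∀ {μs} → AllPairs _≥_ μs → ∃[ xs ] ∃[ ms ] Join xs ms μs
unjoin [] = [] , [] , []
unjoin (m≥ ∷ μs≥) with unjoin μs≥
... | _ , _ , J = join-∷ _ (proj₁ (All-join⁻ J m≥)) (proj₂ (All-join⁻ J m≥)) J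

-- The number of occurrences of m in m ∷ μs and in μs cannot both be even.
join-parity : ∀ {m xs ms xs′ ms′ μs} → All (_< m) xs → Join xs ms (m ∷ μs) →
  All (_< m) xs′ → Join xs′ ms′ μs → ⊥
join-parity (m<m ∷ _) (single _ _ _) _   _ = <-irrefl refl m<m
join-parity lt        (pair _ _ J)   lt′ K = join-parity lt′ K lt J

unjoin-unique : ∀ {xs ms xs′ ms′ μs} → Join xs ms μs → Join xs′ ms′ μs → xs ≡ xs′ × ms ≡ ms′
unjoin-unique []             []             = refl , refl
unjoin-unique (single _ _ J) (single _ _ K) with refl , refl ← unjoin-unique J K = refl , refl
unjoin-unique (pair _ _ J)   (pair _ _ K)   with refl , refl ← unjoin-unique J K = refl , refl
unjoin-unique (single lt _ J) (pair lt′ _ K) = ⊥-elim (join-parity lt J lt′ K)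
unjoin-unique (pair lt _ J) (single lt′ _ K) = ⊥-elim (join-parity lt′ K lt J)

join-unique : ∀ {xs ms μs μs′} → Join xs ms μs → Join xs ms μs′ → μs ≡ μs′
join-unique []             []             = refl
join-unique (single _ _ J) (single _ _ K) = cong (_ ∷_) (join-unique J K)
join-unique (pair _ _ J)   (pair _ _ K)   = cong (λ μs → _ ∷ _ ∷ μs) (join-unique J K)
join-unique (single _ (m≤x ∷ _) _) (pair (x<m ∷ _) _ _) = contradiction m≤x (<⇒≱ x<m)
join-unique (pair (x<m ∷ _) _ _) (single _ (m≤x ∷ _) _) = contradiction m≤x (<⇒≱ x<m)

-- Distinct primary parts as raised staircases

-- The primary parts of the colours spelled by w, raised by μs above the lowest
-- staircase; only used for lists of equal length.
staircase : List Color → List ℕ → List ℕ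
staircase (p ∷ w) (μ ∷ μs) = primary p (μ + δ (p ∷ w)) ∷ staircase w μs
staircase _       _        = []

-- The two finite facts about ε behind primary->.
ε-margins : ∀ p q → res q < ε p q * 10 + res p × ε p q * 10 + res p ≤ res q + 10
ε-margins = from-yes (all-colors? λ p → all-colors? λ q →
  (res q <? ε p q * 10 + res p) ×-dec (ε p q * 10 + res p ≤? res q + 10))

primary-> : ∀ p q k l → primary p k > primary q l ⇔ l + ε p q ≤ k
primary-> p q k l = mk⇔ to from
  where
  open ≤-Reasoning
  from : l + ε p q ≤ k → primary p k > primary q l
  from h = begin-strict
    l * 10 + res q                  <⟨ +-monoʳ-< (l * 10) (proj₁ (ε-margins p q)) ⟩
    l * 10 + (ε p q * 10 + res p)   ≡⟨ lemma l (ε p q) (res p) ⟨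
    (l + ε p q) * 10 + res p        ≤⟨ +-monoˡ-≤ (res p) (*-monoˡ-≤ 10 h) ⟩
    k * 10 + res p                  ∎
    where
    lemma : ∀ l e r → (l + e) * 10 + r ≡ l * 10 + (e * 10 + r)
    lemma = solve-∀
  to : primary p k > primary q l → l + ε p q ≤ k
  to h = ≮⇒≥ λ k< → <⇒≱ h (+-cancelˡ-≤ 10 _ _ (begin
    10 + (k * 10 + res p)           ≡⟨ +-assoc 10 (k * 10) (res p) ⟨
    suc k * 10 + res p              ≤⟨ +-monoˡ-≤ (res p) (*-monoˡ-≤ 10 k<) ⟩
    (l + ε p q) * 10 + res p        ≡⟨ lemma₁ l (ε p q) (res p) ⟩
    l * 10 + (ε p q * 10 + res p)   ≤⟨ +-monoʳ-≤ (l * 10) (proj₂ (ε-margins p q)) ⟩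
    l * 10 + (res q + 10)           ≡⟨ lemma₂ l (res q) ⟩
    10 + (l * 10 + res q)           ∎))
    where
    lemma₁ : ∀ l e r → (l + e) * 10 + r ≡ l * 10 + (e * 10 + r)
    lemma₁ = solve-∀
    lemma₂ : ∀ l r → l * 10 + (r + 10) ≡ 10 + (l * 10 + r)
    lemma₂ = solve-∀

staircase-> : ∀ w {μs} → Linked _≥_ μs → Linked _>_ (staircase w μs)
staircase-> []          _            = []
staircase-> (p ∷ w)     []           = []
staircase-> (p ∷ [])    [-]          = [-]
staircase-> (p ∷ q ∷ w) [-]          = [-]
staircase-> (p ∷ [])    (_ ∷ _)      = [-]
staircase-> (p ∷ q ∷ w) {x ∷ y ∷ _} (y≤x ∷ l) =
  Equivalence.from (primary-> p q _ _) (≤-trans (≤-reflexive (lemma y (δ (q ∷ w)) (ε p q))) (+-monoˡ-≤ _ y≤x))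
  ∷ staircase-> (q ∷ w) l
  where
  lemma : ∀ y d e → y + d + e ≡ y + (e + d)
  lemma = solve-∀

staircase-residues : ∀ w μs → All (λ z → z % 10 ∈ 4 ∷ 6 ∷ 9 ∷ []) (staircase w μs)
staircase-residues []      _        = []
staircase-residues (_ ∷ _) []       = []
staircase-residues (p ∷ w) (μ ∷ μs) =
  subst (_∈ 4 ∷ 6 ∷ 9 ∷ []) (sym (primary-%10 p (μ + δ (p ∷ w)))) (res∈ p) ∷ staircase-residues w μs
  where
  res∈ : ∀ p → res p ∈ 4 ∷ 6 ∷ 9 ∷ []
  res∈ a = here refl
  res∈ b = there (here refl)
  res∈ c = there (there (here refl))

primary-view : ∀ z → z % 10 ∈ 4 ∷ 6 ∷ 9 ∷ [] → ∃[ p ] ∃[ k ] z ≡ primary p k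
primary-view z h = go h (trans (m≡m%n+[m/n]*n z 10) (+-comm (z % 10) (z / 10 * 10)))
  where
  go : ∀ {r} → r ∈ 4 ∷ 6 ∷ 9 ∷ [] → z ≡ z / 10 * 10 + r → ∃[ p ] ∃[ k ] z ≡ primary p k
  go (here refl)                 eq = a , z / 10 , eq
  go (there (here refl))         eq = b , z / 10 , eq
  go (there (there (here refl))) eq = c , z / 10 , eq

-- Consecutive heights drop by at least ε, so each height is at least that of the
-- lowest staircase, and the excesses decrease weakly.
unstaircase : ∀ {zs} → Linked _>_ zs → All (λ z → z % 10 ∈ 4 ∷ 6 ∷ 9 ∷ []) zs →
  ∃[ w ] ∃[ μs ] length w ≡ length μs × Linked _≥_ μs × staircase w μs ≡ zs
unstaircase [] _ = [] , [] , refl , [] , refl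
unstaircase {z ∷ _} l (h ∷ hs) with primary-view z h | unstaircase (Linked.tail l) hs
... | p , k , refl | [] , [] , _ , _ , refl =
  p ∷ [] , k ∷ [] , refl , [-] , cong (λ k → primary p k ∷ []) (+-identityʳ k)
... | p , k , refl | q ∷ w , y ∷ μs , eq , μs≥ , refl =
  p ∷ q ∷ w , k ∸ D ∷ y ∷ μs , cong suc eq , m+n≤o⇒m≤o∸n y bound ∷ μs≥
  , cong (λ k → primary p k ∷ _) (m∸n+n≡m (m+n≤o⇒n≤o y bound))
  where
  D = δ (p ∷ q ∷ w)
  lemma : ∀ y d e → y + (e + d) ≡ y + d + e
  lemma = solve-∀
  bound : y + D ≤ k
  bound = ≤-trans (≤-reflexive (lemma y (δ (q ∷ w)) (ε p q)))
    (Equivalence.to (primary-> p q k _) (Linked.head l))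

staircase-injective : ∀ w w′ {μs μs′} → length w ≡ length μs → length w′ ≡ length μs′ →
  staircase w μs ≡ staircase w′ μs′ → w ≡ w′ × μs ≡ μs′
staircase-injective []      []       {[]}    {[]}     _ _ _ = refl , refl
staircase-injective []      (_ ∷ _)  {[]}    {_ ∷ _}  _ _ ()
staircase-injective (_ ∷ _) []       {_ ∷ _} {[]}     _ _ ()
staircase-injective (p ∷ w) (q ∷ w′) {x ∷ μs} {y ∷ μs′} eq eq′ h = same
  (staircase-injective w w′ (suc-injective eq) (suc-injective eq′) (∷-injectiveʳ h))
  (primary-injective p q (x + δ (p ∷ w)) (y + δ (q ∷ w′)) (∷-injectiveˡ h))
  where
  same : w ≡ w′ × μs ≡ μs′ → p ≡ q × x + δ (p ∷ w) ≡ y + δ (q ∷ w′) →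
    p ∷ w ≡ q ∷ w′ × x ∷ μs ≡ y ∷ μs′
  same (refl , refl) (refl , e) = refl , cong (_∷ μs) (+-cancelʳ-≡ (δ (p ∷ w)) x y e)

-- Values and residues of primary and secondary parts

excludedValues excludedResidues : List ℕ
excludedValues   = 2 ∷ 3 ∷ 5 ∷ 8 ∷ []
excludedResidues = 1 ∷ 7 ∷ 11 ∷ 12 ∷ 17 ∷ []

rem-admissible : ∀ σ → rem σ ∉ excludedValues × rem σ % 20 ∉ excludedResidues × 1 ≤ rem σ
rem-admissible = from-yes (all-shapes? λ σ →
  (rem σ ∉? excludedValues) ×-dec ((rem σ % 20 ∉? excludedResidues) ×-dec (1 ≤? rem σ)))

-- Either the residue r is excluded, or the least part in its class is r, or that
-- least part is 20 + r; the last occurs only if r is 0 or an excluded value.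
Covered : ℕ → Set
Covered r =
  r ∈ excludedResidues ⊎
  Any (λ σ → r ≡ rem σ) shapes ⊎
  (r ∈ 0 ∷ excludedValues × Any (λ σ → 20 + r ≡ rem σ) shapes)

residue-covered : ∀ (r : Fin 20) → Covered (toℕ r)
residue-covered = from-yes (Fin.all? {n = 20} λ r →
  (toℕ r ∈? excludedResidues) ⊎-dec
  (Any.any? (λ σ → toℕ r ≟ rem σ) shapes ⊎-dec
  ((toℕ r ∈? 0 ∷ excludedValues) ×-dec Any.any? (λ σ → 20 + toℕ r ≟ rem σ) shapes)))

-- Numbers of the form value σ K.
data Valued : ℕ → Set where
  valued : ∀ σ K → Valued (value σ K)

value-positive : ∀ σ K → 1 ≤ value σ K
value-positive σ K = ≤-trans (proj₂ (proj₂ (rem-admissible σ))) (m≤n+m (rem σ) (K * 20))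

value-∉ : ∀ σ K → value σ K ∉ excludedValues
value-∉ σ zero    = proj₁ (rem-admissible σ)
value-∉ σ (suc K) (here ())
value-∉ σ (suc K) (there (here ()))
value-∉ σ (suc K) (there (there (here ())))
value-∉ σ (suc K) (there (there (there (here ()))))

value-%20-∉ : ∀ σ K → value σ K % 20 ∉ excludedResidues
value-%20-∉ σ K = subst (_∉ excludedResidues) (sym (value-%20 σ K)) (proj₁ (proj₂ (rem-admissible σ)))

allowed⇒valued : ∀ z → 1 ≤ z → z ∉ excludedValues → z % 20 ∉ excludedResidues → Valued z
allowed⇒valued z 1≤z z∉ r∉ =
  go (z / 20) (trans (m≡m%n+[m/n]*n z 20) (+-comm (z % 20) (z / 20 * 20)))
     (subst Covered (Fin.toℕ-fromℕ< (m%n<n z 20)) (residue-covered (Fin.fromℕ< (m%n<n z 20))))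
  where
  go : ∀ K → z ≡ K * 20 + z % 20 → Covered (z % 20) → Valued z
  go K z≡ (inj₁ r∈) = contradiction r∈ r∉
  go K z≡ (inj₂ (inj₁ r-rem)) with σ , r≡ ← Any.satisfied r-rem =
    subst Valued (sym (trans z≡ (cong (K * 20 +_) r≡))) (valued σ K)
  go zero z≡ (inj₂ (inj₂ (r∈ , _))) with subst (_∈ 0 ∷ excludedValues) (sym z≡) r∈
  ... | here z≡0 = contradiction (subst (1 ≤_) z≡0 1≤z) λ ()
  ... | there z∈ = contradiction z∈ z∉
  go (suc K) z≡ (inj₂ (inj₂ (_ , r-rem))) with σ , r≡ ← Any.satisfied r-rem =
    subst Valued
      (sym (trans z≡ (trans (lemma (K * 20) (z % 20)) (cong (K * 20 +_) r≡)))) (valued σ K)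
    where
    lemma : ∀ k r → 20 + k + r ≡ k + (20 + r)
    lemma = solve-∀

valued⇒admissible : ∀ {z} → Valued z → Admissible z
valued⇒admissible (valued (one p i) K) =
  subst Admissible (primary-value p K i) (isPrimary p (K * 2 + toℕ i))
valued⇒admissible (valued (two p q) K) =
  subst Admissible (secondary-value p q K) (isSecondary p q K)

primary-valued : ∀ p k → Valued (primary p k)
primary-valued p k with halve k
... | halved K i = subst Valued (sym (primary-value p K i)) (valued (one p i) K)

secondary-valued : ∀ p q K → Valued (secondary p q K)
secondary-valued p q K = subst Valued (sym (secondary-value p q K)) (valued (two p q) K)

parts-valued : ∀ ts → All Valued (parts ts)
parts-valued []                = []
parts-valued (single p x ∷ ts) = primary-valued p (x + δ (p ∷ word ts)) ∷ parts-valued ts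
parts-valued (pair p q m ∷ ts) = secondary-valued p q (m + δ (q ∷ word ts)) ∷ parts-valued ts

-- Counting letters

-- Whether d and p are the same colour, as a number.
occ : Color → Color → ℕ
occ d p = if res d ≡ᵇ res p then 1 else 0

count : Color → List Color → ℕ
count d []      = 0
count d (p ∷ w) = occ d p + count d w

-- Whether a residue is in a given list, as a number.
mark : List ℕ → ℕ → ℕ
mark rs r = if does (r ∈? rs) then 1 else 0

#parts-∷ : ∀ m .{{_ : NonZero m}} rs z zs → #parts (z ∷ zs) m rs ≡ mark rs (z % m) + #parts zs m rs
#parts-∷ m rs z zs with does ((z % m) ∈? rs)
... | true  = refl
... | false = refl

-- The residues modulo 10 of the parts that count once for a colour, and those
-- modulo 20 of the parts that count twice.
tens twenties : Color → List ℕ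
tens a = 0 ∷ 3 ∷ 4 ∷ []
tens b = 0 ∷ 5 ∷ 6 ∷ []
tens c = 3 ∷ 5 ∷ 9 ∷ []
twenties a = 18 ∷ []
twenties b = 2 ∷ []
twenties c = 8 ∷ []

-- The quantity that is prescribed for the colour d on the side of the gap conditions;
-- weight d z is the contribution of a single part z.
tally : Color → List ℕ → ℕ
tally d zs = #parts zs 10 (tens d) + 2 * #parts zs 20 (twenties d)

weight : Color → ℕ → ℕ
weight d z = mark (tens d) (z % 10) + 2 * mark (twenties d) (z % 20)

tally-∷ : ∀ d z zs → tally d (z ∷ zs) ≡ weight d z + tally d zs
tally-∷ d z zs = trans
  (cong₂ (λ i j → i + 2 * j) (#parts-∷ 10 (tens d) z zs) (#parts-∷ 20 (twenties d) z zs))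
  (lemma (mark (tens d) (z % 10)) (#parts zs 10 (tens d)) 
    (mark (twenties d) (z % 20)) (#parts zs 20 (twenties d)))
  where
  lemma : ∀ i j k l → i + j + 2 * (k + l) ≡ i + 2 * k + (j + 2 * l)
  lemma = solve-∀

letters : Color → Shape → ℕ
letters d (one p i) = occ d p
letters d (two p q) = occ d p + occ d q

weight-rem : ∀ d σ → weight d (rem σ) ≡ letters d σ
weight-rem = from-yes (all-colors? λ d → all-shapes? λ σ → weight d (rem σ) ≟ letters d σ)

weight-value : ∀ d σ K → weight d (value σ K) ≡ letters d σ
weight-value d σ K = trans
  (cong₂ (λ i j → mark (tens d) i + 2 * mark (twenties d) j) (value-%10 σ K) (value-%20 σ K))
  (weight-rem d σ)

weight-primary : ∀ d p k → weight d (primary p k) ≡ occ d p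
weight-primary d p k with halve k
... | halved K i = trans (cong (weight d) (primary-value p K i)) (weight-value d (one p i) K)

weight-secondary : ∀ d p q K → weight d (secondary p q K) ≡ occ d p + occ d q
weight-secondary d p q K = trans (cong (weight d) (secondary-value p q K)) (weight-value d (two p q) K)

tally-parts : ∀ d ts → tally d (parts ts) ≡ count d (word ts)
tally-parts d [] = refl
tally-parts d (single p x ∷ ts) = trans
  (tally-∷ d (primary p (x + δ (p ∷ word ts))) (parts ts))
  (cong₂ _+_ (weight-primary d p (x + δ (p ∷ word ts))) (tally-parts d ts))
tally-parts d (pair p q m ∷ ts) = trans
  (tally-∷ d (secondary p q (m + δ (q ∷ word ts))) (parts ts))
  (trans (cong₂ _+_ (weight-secondary d p q (m + δ (q ∷ word ts))) (tally-parts d ts))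
         (+-assoc (occ d p) (occ d q) (count d (word ts))))

mark-res : ∀ d p → mark (res d ∷ []) (res p) ≡ occ d p
mark-res = from-yes (all-colors? λ d → all-colors? λ p → mark (res d ∷ []) (res p) ≟ occ d p)

staircase-count : ∀ d w μs → length w ≡ length μs →
  #parts (staircase w μs) 10 (res d ∷ []) ≡ count d w
staircase-count d []      []       _  = refl
staircase-count d (p ∷ w) (μ ∷ μs) eq = trans
  (#parts-∷ 10 (res d ∷ []) (primary p (μ + δ (p ∷ w))) (staircase w μs))
  (cong₂ _+_
    (trans (cong (mark (res d ∷ [])) (primary-%10 p (μ + δ (p ∷ w)))) (mark-res d p))
    (staircase-count d w μs (suc-injective eq)))

-- Sums of parts

-- The sum of the lowest staircase that spells a word.
ground : List Color → ℕ
ground []      = 0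
ground (p ∷ w) = primary p (δ (p ∷ w)) + ground w

sum-staircase : ∀ w μs → length w ≡ length μs → sum (staircase w μs) ≡ sum μs * 10 + ground w
sum-staircase []      []       _  = refl
sum-staircase (p ∷ w) (μ ∷ μs) eq = trans
  (cong (primary p (μ + δ (p ∷ w)) +_) (sum-staircase w μs (suc-injective eq)))
  (lemma μ (δ (p ∷ w)) (res p) (sum μs) (ground w))
  where
  lemma : ∀ μ d r s g → (μ + d) * 10 + r + (s * 10 + g) ≡ (μ + s) * 10 + (d * 10 + r + g)
  lemma = solve-∀

sum-parts : ∀ ts → sum (parts ts) ≡ (sum (singles ts) + sum (pairs ts) * 2) * 10 + ground (word ts)
sum-parts [] = refl
sum-parts (single p x ∷ ts) = trans
  (cong (primary p (x + δ (p ∷ word ts)) +_) (sum-parts ts))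
  (lemma x (δ (p ∷ word ts)) (res p) (sum (singles ts)) (sum (pairs ts)) (ground (word ts)))
  where
  lemma : ∀ x d r s t g →
    (x + d) * 10 + r + ((s + t * 2) * 10 + g) ≡ (x + s + t * 2) * 10 + (d * 10 + r + g)
  lemma = solve-∀
sum-parts (pair p q m ∷ ts) = trans
  (cong (secondary p q (m + δ (q ∷ word ts)) +_) (sum-parts ts))
  (lemma m (δ (q ∷ word ts)) (ε p q) (res p) (res q)
    (sum (singles ts)) (sum (pairs ts)) (ground (word ts)))
  where
  lemma : ∀ m d e r r′ s t g →
    (m + d + e) * 10 + r + ((m + d) * 10 + r′) + ((s + t * 2) * 10 + g)
      ≡ (s + (m + t) * 2) * 10 + ((e + d) * 10 + r + (d * 10 + r′ + g))
  lemma = solve-∀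

-- Both kinds of partition from a merged tiling

gap⇒≥ : ∀ {z y} → GapCondition z y → z ≥ y
gap⇒≥ {z} {y} (9≤ , _) = <⇒≤ (m∸n≢0⇒n<m λ z∸y≡0 → contradiction (subst (9 ≤_) z∸y≡0 9≤) λ ())

parts-isPartition : ∀ {ts} → Merged ts → IsPartition (sum (parts ts)) (parts ts)
parts-isPartition {ts} M = record
  { nonIncreasing = Linked.map gap⇒≥ (merged⇒linked M)
  ; positive      = All.map (λ { (valued σ K) → value-positive σ K }) (parts-valued ts)
  ; sum≡          = refl
  }

parts-isB : ∀ {ts} → Merged ts →
  IsB (count a (word ts)) (count b (word ts)) (count c (word ts)) (parts ts)
parts-isB {ts} M = record
  { values   = All.map (λ { (valued σ K) → value-∉ σ K }) (parts-valued ts)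
  ; residues = All.map (λ { (valued σ K) → value-%20-∉ σ K }) (parts-valued ts)
  ; count-u  = sym (tally-parts a ts)
  ; count-v  = sym (tally-parts b ts)
  ; count-w  = sym (tally-parts c ts)
  ; gaps     = merged⇒linked M
  }

staircase-isPartition : ∀ w {μs} → AllPairs _≥_ μs → IsPartition (sum (staircase w μs)) (staircase w μs)
staircase-isPartition w {μs} μs≥ = record
  { nonIncreasing = Linked.map <⇒≤ (staircase-> w (AllPairs⇒Linked μs≥))
  ; positive      = positive w μs
  ; sum≡          = refl
  }
  where
  res-positive : ∀ p → 1 ≤ res p
  res-positive = from-yes (all-colors? λ p → 1 ≤? res p)
  positive : ∀ w μs → All (1 ≤_) (staircase w μs)
  positive []      _        = []
  positive (_ ∷ _) []       = []
  positive (p ∷ w) (μ ∷ μs) =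
    ≤-trans (res-positive p) (m≤n+m (res p) ((μ + δ (p ∷ w)) * 10)) ∷ positive w μs

staircase-isA : ∀ w {μs} → length w ≡ length μs → AllPairs _≥_ μs →
  IsA (count a w) (count b w) (count c w) (staircase w μs)
staircase-isA w {μs} eq μs≥ = record
  { distinct = AllPairs.map >⇒≢
      (Linked⇒AllPairs (λ i>j j>k → <-trans j>k i>j) (staircase-> w (AllPairs⇒Linked μs≥)))
  ; residues = staircase-residues w μs
  ; count-u  = staircase-count a w μs eq
  ; count-v  = staircase-count b w μs eq
  ; count-w  = staircase-count c w μs eq
  }

-- The correspondence

-- A partition into distinct primary parts and a partition with gap conditions
-- correspond if they come from the same word and the same amounts.
data Corresponds : List ℕ → List ℕ → Set where
  corresponds : ∀ {ts μs} → Merged ts → Join (singles ts) (pairs ts) μs →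
    Corresponds (staircase (word ts) μs) (parts ts)

length-word : ∀ ts → length (word ts) ≡ length (singles ts) + length (pairs ts) * 2
length-word []                = refl
length-word (single p x ∷ ts) = cong suc (length-word ts)
length-word (pair p q m ∷ ts) =
  trans (cong (suc ∘ suc) (length-word ts)) (lemma (length (singles ts)) (length (pairs ts)))
  where
  lemma : ∀ i j → 2 + (i + j * 2) ≡ i + (1 + j) * 2
  lemma = solve-∀

join-length : ∀ ts {μs} → Join (singles ts) (pairs ts) μs → length (word ts) ≡ length μs
join-length ts J = trans (length-word ts) (sym (length-join J))

singles-decreasing : ∀ {ts} → Merged ts → AllPairs _>_ (singles ts)
singles-decreasing []              = []
singles-decreasing (single lt _ M) = lt ∷ singles-decreasing M
singles-decreasing (pair _ _ M)    = singles-decreasing M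

pairs-nonincreasing : ∀ {ts} → Merged ts → AllPairs _≥_ (pairs ts)
pairs-nonincreasing []             = []
pairs-nonincreasing (single _ _ M) = pairs-nonincreasing M
pairs-nonincreasing (pair _ le M)  = le ∷ pairs-nonincreasing M

-- Membership in the set counted by A, and in the set counted by B.
InA InB : (u v w n : ℕ) → List ℕ → Set
InA u v w n ps = IsPartition n ps × IsA u v w ps
InB u v w n ps = IsPartition n ps × IsB u v w ps

corresponds-sum : ∀ {λs βs} → Corresponds λs βs → sum λs ≡ sum βs
corresponds-sum (corresponds {ts} {μs} M J) = begin
  sum (staircase (word ts) μs)                                    ≡⟨ sum-staircase (word ts) μs (join-length ts J) ⟩
  sum μs * 10 + ground (word ts)                                  ≡⟨ cong (λ s → s * 10 + ground (word ts)) (sum-join J) ⟩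
  (sum (singles ts) + sum (pairs ts) * 2) * 10 + ground (word ts) ≡⟨ sum-parts ts ⟨
  sum (parts ts)                                                  ∎
  where open ≡-Reasoning

A⇒B : ∀ {u v w n λs βs} → Corresponds λs βs → InA u v w n λs → InB u v w n βs
A⇒B C@(corresponds {ts} {μs} M J) (P , Q)
  with refl ← trans (sym (corresponds-sum C)) (IsPartition.sum≡ P)
  with refl ← trans (sym (staircase-count a (word ts) μs (join-length ts J))) (IsA.count-u Q)
     | refl ← trans (sym (staircase-count b (word ts) μs (join-length ts J))) (IsA.count-v Q)
     | refl ← trans (sym (staircase-count c (word ts) μs (join-length ts J))) (IsA.count-w Q)
  = parts-isPartition M , parts-isB M

B⇒A : ∀ {u v w n λs βs} → Corresponds λs βs → InB u v w n βs → InA u v w n λs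
B⇒A C@(corresponds {ts} {μs} M J) (P , Q)
  with refl ← trans (corresponds-sum C) (IsPartition.sum≡ P)
  with refl ← trans (IsB.count-u Q) (tally-parts a ts)
     | refl ← trans (IsB.count-v Q) (tally-parts b ts)
     | refl ← trans (IsB.count-w Q) (tally-parts c ts)
  = staircase-isPartition (word ts) (join-sorted J)
  , staircase-isA (word ts) (join-length ts J) (join-sorted J)

-- Unjoin the amounts of the staircase and merge them along its word.
A-total : ∀ {u v w n λs} → InA u v w n λs → ∃[ βs ] Corresponds λs βs
A-total (P , Q)
  with w , μs , eq , μs≥ , refl ← unstaircase
         (AllPairs⇒Linked (AllPairs.map (λ (y≤x , x≢y) → ≤∧≢⇒< y≤x (x≢y ∘ sym))
           (AllPairs.zip
             ( Linked⇒AllPairs (λ i≥j j≥k → ≤-trans j≥k i≥j) (IsPartition.nonIncreasing P)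
             , IsA.distinct Q))))
         (IsA.residues Q)
  with xs , ms , J ← unjoin (Linked⇒AllPairs (λ i≥j j≥k → ≤-trans j≥k i≥j) μs≥)
  with ts , M , refl , refl , refl ←
         merge w xs ms (singles-sorted J) (pairs-sorted J) (trans eq (length-join J))
  = parts ts , corresponds M J

-- Read off the tiles from the gap conditions and join their amounts.
B-total : ∀ {u v w n βs} → InB u v w n βs → ∃[ λs ] Corresponds λs βs
B-total {βs = βs} (P , Q)
  with ts , M , refl ← linked⇒merged
         (All.zipWith (λ { {z} (1≤z , z∉ , r∉) → valued⇒admissible (allowed⇒valued z 1≤z z∉ r∉) })
           (IsPartition.positive P , All.zip (IsB.values Q , IsB.residues Q)))
         (IsB.gaps Q)
  with μs , J ← join (singles-decreasing M) (pairs-nonincreasing M)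
  = staircase (word ts) μs , corresponds M J

-- The parts determine the tiles, and these the joined amounts.
A-determined : ∀ {λs λs′ βs βs′} → Corresponds λs βs → Corresponds λs′ βs′ → βs ≡ βs′ → λs ≡ λs′
A-determined (corresponds {ts} _ J) (corresponds {ts′} _ J′) eq
  with refl ← parts-injective ts ts′ eq
  = cong (staircase (word ts)) (join-unique J J′)

-- The staircase determines its word and amounts, hence the single and pair amounts,
-- and there is only one way to merge these.
B-determined : ∀ {λs λs′ βs βs′} → Corresponds λs βs → Corresponds λs′ βs′ → λs ≡ λs′ → βs ≡ βs′
B-determined (corresponds {ts} M J) (corresponds {ts′} M′ J′) eq
  with eq-w , refl ←
         staircase-injective (word ts) (word ts′) (join-length ts J) (join-length ts′ J′) eq
  = cong parts (merged-unique M M′ eq-w (proj₁ (unjoin-unique J J′)) (proj₂ (unjoin-unique J J′)))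

-- Counting

unique-lookup : ∀ {X : Set} {xs : List X} → Unique xs → ∀ i j → lookup xs i ≡ lookup xs j → i ≡ j
unique-lookup (x∉ ∷ u) Fin.zero    Fin.zero    _  = refl
unique-lookup (x∉ ∷ u) Fin.zero    (Fin.suc j) eq = contradiction eq (All.lookup x∉ (∈-lookup j))
unique-lookup (x∉ ∷ u) (Fin.suc i) Fin.zero    eq = contradiction (sym eq) (All.lookup x∉ (∈-lookup i))
unique-lookup (x∉ ∷ u) (Fin.suc i) (Fin.suc j) eq = cong Fin.suc (unique-lookup u i j eq)

-- A relation that is total on a list without repetitions, and relates no two elements
-- to the same one, bounds the length of that list by that of the other list.
length-≤ : ∀ {X Y : Set} {R : X → Y → Set} {xs ys} → Unique xs →
  (∀ {x} → x ∈ xs → ∃[ y ] y ∈ ys × R x y) →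
  (∀ {x x′ y} → R x y → R x′ y → x ≡ x′) →
  length xs ≤ length ys
length-≤ {R = R} {xs} {ys} u total inj = Fin.injective⇒≤ {f = index} λ {i} {j} eq →
  unique-lookup u i j (inj (related i) (subst (λ k → R (lookup xs j) (lookup ys k)) (sym eq) (related j)))
  where
  index : Fin (length xs) → Fin (length ys)
  index i = Any.index (proj₁ (proj₂ (total (∈-lookup i))))
  related : ∀ i → R (lookup xs i) (lookup ys (index i))
  related i with total (∈-lookup i)
  ... | y , y∈ , r = subst (R (lookup xs i)) (lookup-index y∈) r

corollary1p5 : (u v w n : ℕ) → A u v w n ≡ B u v w n
corollary1p5 u v w n = ≤-antisym
  (length-≤ (filter⁺ (isA? u v w) (partitions-unique n))
    (λ λs∈ → let h = from-A λs∈ ; βs , C = A-total h in βs , to-B (A⇒B C h) , C)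
    (λ {_} {_} {βs} C C′ → A-determined C C′ (refl {x = βs})))
  (length-≤ {R = λ βs λs → Corresponds λs βs} (filter⁺ (isB? u v w) (partitions-unique n))
    (λ βs∈ → let h = from-B βs∈ ; λs , C = B-total h in λs , to-A (B⇒A C h) , C)
    (λ {_} {_} {λs} C C′ → B-determined C C′ (refl {x = λs})))
  where
  from-A : ∀ {ps} → ps ∈ filter (isA? u v w) (partitions n) → InA u v w n ps
  from-A ps∈ =
    let ps∈′ , h = ∈-filter⁻ (isA? u v w) ps∈
    in Equivalence.to (∈-partitions n _) ps∈′ , h
  from-B : ∀ {ps} → ps ∈ filter (isB? u v w) (partitions n) → InB u v w n ps
  from-B ps∈ =
    let ps∈′ , h = ∈-filter⁻ (isB? u v w) ps∈
    in Equivalence.to (∈-partitions n _) ps∈′ , h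
  to-A : ∀ {ps} → InA u v w n ps → ps ∈ filter (isA? u v w) (partitions n)
  to-A (P , h) = ∈-filter⁺ (isA? u v w) (Equivalence.from (∈-partitions n _) P) h
  to-B : ∀ {ps} → InB u v w n ps → ps ∈ filter (isB? u v w) (partitions n)
  to-B (P , h) = ∈-filter⁺ (isB? u v w) (Equivalence.from (∈-partitions n _) P) h
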